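{- Let $f:\mathbb{N}\to\mathbb{C}$ be an arithmetic function (where $\mathbb{N}=\{1,2,3,\dots\}$) and let $s\ge 1$ be real. Suppose that the series $\sum_{n=1}^{\infty}\frac{f(n)}{n^s}$ converges and the series $\sum_{n=1}^{\infty}\frac{f(n)}{n^{s-1}}$ diverges. Then $$\sum_{n\le x}\frac{f(n)}{n^{s-1}}=o(x),\qquad x\to\infty.$$
   Context: An arithmetic function is a function defined on the positive integers with complex values. Sums $\sum_{n\le x}$ run over positive integers $n\le x$. Convergence of a series means convergence of its partial sums to a finite limit (not necessarily absolute convergence). $A(x)=o(x)$ as $x\to\infty$ means $A(x)/x\to 0$. -}

module Defs where

open import Data.Integer.Base as ℤ using (+_)
import Data.Integer.Properties as ℤP
open import Data.Nat.Base as ℕ using (ℕ; zero; suc)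
import Data.Nat.Properties as ℕP
open import Data.Product.Base using (Σ; _,_; _×_; ∃; ∃-syntax; proj₁; proj₂)
open import Data.Rational.Base
open import Data.Rational.Properties
open import Data.Rational.Solver using (module +-*-Solver)
import Data.Rational.Unnormalised.Base as ℚᵘ
import Data.Rational.Unnormalised.Properties as ℚᵘP
open import Relation.Binary.PropositionalEquality
open import Data.Sum.Base using (inj₁; inj₂)
open import Relation.Nullary using (¬_)

open +-*-Solver using (solve; con; _:+_; _:*_; _:-_; :-_; _:=_)

telescope : ∀ p q r → (p - q) + (q - r) ≡ p - r
telescope = solve 3 (λ p q r → (p :- q) :+ (q :- r) := p :- r) refl

neg-minus : ∀ p q → - (p - q) ≡ q - p
neg-minus = solve 2 (λ p q → :- (p :- q) := q :- p) refl

add-sub : ∀ l w → (l + w) - l ≡ w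
add-sub = solve 2 (λ l w → (l :+ w) :- l := w) refl

sub-add : ∀ p q → p ≡ (p - q) + q
sub-add = solve 2 (λ a b → a := (a :- b) :+ b) refl

split-* : ∀ p q r s → p * q - r * s ≡ (p - r) * q + r * (q - s)
split-* = solve 4 (λ p q r s → p :* q :- r :* s := (p :- r) :* q :+ r :* (q :- s)) refl

split-+ : ∀ p q r s → (p + q) - (r + s) ≡ (p - r) + (q - s)
split-+ = solve 4 (λ a b c d → (a :+ b) :- (c :+ d) := (a :- c) :+ (b :- d)) refl

split-neg : ∀ p q → - (p - q) ≡ - p - - q
split-neg = solve 2 (λ a b → :- (a :- b) := (:- a) :- (:- b)) refl

swap-* : ∀ n e r → n * e * r ≡ r * n * e
swap-* = solve 3 (λ n e r → n :* e :* r := (r :* n) :* e) refl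

1/-split : ∀ a b x y → (x * y) * (b - a) ≡ x * (y * b) - y * (x * a)
1/-split = solve 4 (λ a b x y → (x :* y) :* (b :- a) := x :* (y :* b) :- y :* (x :* a)) refl

0≤* : ∀ {p q} → 0ℚ ≤ p → 0ℚ ≤ q → 0ℚ ≤ p * q
0≤* {p} {q} 0≤p 0≤q =
  nonNegative⁻¹ (p * q) {{nonNeg*nonNeg⇒nonNeg p {{nonNegative 0≤p}} q {{nonNegative 0≤q}}}}

0<* : ∀ {p q} → 0ℚ < p → 0ℚ < q → 0ℚ < p * q
0<* {p} {q} 0<p 0<q =
  positive⁻¹ (p * q) {{pos*pos⇒pos p {{positive 0<p}} q {{positive 0<q}}}}

*-mono : ∀ {p q r s} → 0ℚ ≤ p → 0ℚ ≤ s → p ≤ q → r ≤ s → p * r ≤ q * s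
*-mono {p} {q} {r} {s} 0≤p 0≤s p≤q r≤s = ≤-trans
  (*-monoˡ-≤-nonNeg p {{nonNegative 0≤p}} r≤s)
  (*-monoʳ-≤-nonNeg s {{nonNegative 0≤s}} p≤q)

0≤+ : ∀ {p q} → 0ℚ ≤ p → 0ℚ ≤ q → 0ℚ ≤ p + q
0≤+ 0≤p 0≤q = +-mono-≤ 0≤p 0≤q

p≤p+q : ∀ {p q} → 0ℚ ≤ q → p ≤ p + q
p≤p+q {p} {q} 0≤q = subst (_≤ p + q) (+-identityʳ p) (+-monoʳ-≤ p 0≤q)

p≤∣p∣ : ∀ p → p ≤ ∣ p ∣
p≤∣p∣ p with ≤-total 0ℚ p
... | inj₁ 0≤p = ≤-reflexive (sym (0≤p⇒∣p∣≡p 0≤p))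
... | inj₂ p≤0 = ≤-trans p≤0 (0≤∣p∣ p)

half : ∀ {ε} → 0ℚ < ε → 0ℚ < ½ * ε
half = 0<* (positive⁻¹ ½)

half+half : ∀ ε → ½ * ε + ½ * ε ≡ ε
half+half = solve 1 (λ e → con ½ :* e :+ con ½ :* e := e) refl

shrink : ∀ C → 0ℚ ≤ C → ∀ ε → 0ℚ < ε → ∃[ δ ] 0ℚ < δ × C * δ ≤ ε
shrink C 0≤C ε 0<ε = δ , 0<δ , Cδ≤ε
  where
  instance
    C+1>0 : Positive (C + 1ℚ)
    C+1>0 = nonNeg+pos⇒pos C {{nonNegative 0≤C}} 1ℚ
    C+1≢0 : NonZero (C + 1ℚ)
    C+1≢0 = pos⇒nonZero (C + 1ℚ)
  r = 1/ (C + 1ℚ)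
  δ = r * ε
  0<δ : 0ℚ < δ
  0<δ = 0<* (positive⁻¹ r {{1/pos⇒pos (C + 1ℚ)}}) 0<ε
  open ≤-Reasoning
  Cδ≤ε : C * δ ≤ ε
  Cδ≤ε = begin
    C * δ            ≤⟨ *-monoʳ-≤-nonNeg δ {{nonNegative (<⇒≤ 0<δ)}} (p≤p+q {C} {1ℚ} (nonNegative⁻¹ 1ℚ)) ⟩
    (C + 1ℚ) * δ     ≡⟨ *-assoc (C + 1ℚ) r ε ⟨
    (C + 1ℚ) * r * ε ≡⟨ cong (_* ε) (*-inverseʳ (C + 1ℚ)) ⟩
    1ℚ * ε           ≡⟨ *-identityˡ ε ⟩
    ε                ∎

∣p-r∣≤ : ∀ p q r → ∣ p - r ∣ ≤ ∣ p - q ∣ + ∣ q - r ∣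
∣p-r∣≤ p q r = subst (λ t → ∣ t ∣ ≤ ∣ p - q ∣ + ∣ q - r ∣)
  (telescope p q r)
  (∣p+q∣≤∣p∣+∣q∣ (p - q) (q - r))

∣p-q∣-sym : ∀ p q → ∣ p - q ∣ ≡ ∣ q - p ∣
∣p-q∣-sym p q = trans (sym (∣-p∣≡∣p∣ (p - q)))
  (cong ∣_∣ (neg-minus p q))

∣-∣≤-both : ∀ {p q lo w} → lo ≤ p → lo ≤ q → p ≤ lo + w → q ≤ lo + w → ∣ p - q ∣ ≤ w
∣-∣≤-both {p} {q} {lo} {w} lp lq pu qu with ∣p∣≡p∨∣p∣≡-p (p - q)
... | inj₁ e = subst (_≤ w) (sym e) (subst (p - q ≤_)
        (add-sub lo w) (+-mono-≤ pu (neg-antimono-≤ lq)))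
... | inj₂ e = subst (_≤ w) (sym e) (subst₂ _≤_
        (sym (neg-minus p q))
        (add-sub lo w) (+-mono-≤ qu (neg-antimono-≤ lp)))

∣pq-rs∣≤ : ∀ p q r s → ∣ p * q - r * s ∣ ≤ ∣ p - r ∣ * ∣ q ∣ + ∣ r ∣ * ∣ q - s ∣
∣pq-rs∣≤ p q r s = begin
  ∣ p * q - r * s ∣                   ≡⟨ cong ∣_∣ (split-* p q r s) ⟩
  ∣ (p - r) * q + r * (q - s) ∣       ≤⟨ ∣p+q∣≤∣p∣+∣q∣ ((p - r) * q) (r * (q - s)) ⟩
  ∣ (p - r) * q ∣ + ∣ r * (q - s) ∣   ≡⟨ cong₂ _+_ (∣p*q∣≡∣p∣*∣q∣ (p - r) q) (∣p*q∣≡∣p∣*∣q∣ r (q - s)) ⟩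
  ∣ p - r ∣ * ∣ q ∣ + ∣ r ∣ * ∣ q - s ∣ ∎
  where open ≤-Reasoning

fromℕ : ℕ → ℚ
fromℕ n = + n / 1

fromℕ-suc : ∀ n → fromℕ (suc n) ≡ 1ℚ + fromℕ n
fromℕ-suc n = toℚᵘ-injective (begin
  toℚᵘ (fromℕ (suc n))                ≈⟨ toℚᵘ-fromℚᵘ (ℚᵘ.mkℚᵘ (+ suc n) 0) ⟩
  ℚᵘ.mkℚᵘ (+ suc n) 0                 ≈⟨ ℚᵘ.*≡* (cong (ℤ._* + 1) (cong (λ i → (+ 1) ℤ.+ i) (sym (ℤP.*-identityʳ (+ n))))) ⟩
  ℚᵘ.1ℚᵘ ℚᵘ.+ ℚᵘ.mkℚᵘ (+ n) 0         ≈⟨ ℚᵘP.+-congʳ ℚᵘ.1ℚᵘ (toℚᵘ-fromℚᵘ (ℚᵘ.mkℚᵘ (+ n) 0)) ⟨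
  ℚᵘ.1ℚᵘ ℚᵘ.+ toℚᵘ (fromℕ n)          ≈⟨ toℚᵘ-homo-+ 1ℚ (fromℕ n) ⟨
  toℚᵘ (1ℚ + fromℕ n)                 ∎)
  where open ℚᵘP.≃-Reasoning

1/n*n : ∀ n → (+ 1 / suc n) * fromℕ (suc n) ≡ 1ℚ
1/n*n n = toℚᵘ-injective (begin
  toℚᵘ ((+ 1 / suc n) * fromℕ (suc n))             ≈⟨ toℚᵘ-homo-* (+ 1 / suc n) (fromℕ (suc n)) ⟩
  toℚᵘ (+ 1 / suc n) ℚᵘ.* toℚᵘ (fromℕ (suc n))     ≈⟨ ℚᵘP.*-cong (toℚᵘ-fromℚᵘ (ℚᵘ.mkℚᵘ (+ 1) n))
                                                                   (toℚᵘ-fromℚᵘ (ℚᵘ.mkℚᵘ (+ suc n) 0)) ⟩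
  ℚᵘ.mkℚᵘ (+ 1) n ℚᵘ.* ℚᵘ.mkℚᵘ (+ suc n) 0         ≈⟨ ℚᵘ.*≡* (cong +_ (e n)) ⟩
  ℚᵘ.1ℚᵘ                                           ∎)
  where
  open ℚᵘP.≃-Reasoning
  e : ∀ n → (1 ℕ.* suc n) ℕ.* 1 ≡ 1 ℕ.* (suc n ℕ.* 1)
  e n = ℕP.*-assoc 1 (suc n) 1

fromℕ*1/ : ∀ m k → fromℕ (suc m) * (+ 1 / (suc m ℕ.* suc k)) ≡ + 1 / suc k
fromℕ*1/ m k = toℚᵘ-injective (begin
  toℚᵘ (fromℕ (suc m) * (+ 1 / (suc m ℕ.* suc k)))            ≈⟨ toℚᵘ-homo-* (fromℕ (suc m)) (+ 1 / (suc m ℕ.* suc k)) ⟩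
  toℚᵘ (fromℕ (suc m)) ℚᵘ.* toℚᵘ (+ 1 / (suc m ℕ.* suc k))    ≈⟨ ℚᵘP.*-cong (toℚᵘ-fromℚᵘ (ℚᵘ.mkℚᵘ (+ suc m) 0))
                                                                   (toℚᵘ-fromℚᵘ (ℚᵘ.mkℚᵘ (+ 1) (k ℕ.+ m ℕ.* suc k))) ⟩
  ℚᵘ.mkℚᵘ (+ suc m) 0 ℚᵘ.* ℚᵘ.mkℚᵘ (+ 1) (k ℕ.+ m ℕ.* suc k)  ≈⟨ ℚᵘ.*≡* (cong +_ e) ⟩
  ℚᵘ.mkℚᵘ (+ 1) k                                             ≈⟨ toℚᵘ-fromℚᵘ (ℚᵘ.mkℚᵘ (+ 1) k) ⟨
  toℚᵘ (+ 1 / suc k)                                          ∎)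
  where
  open ℚᵘP.≃-Reasoning
  e : (suc m ℕ.* 1) ℕ.* suc k ≡ 1 ℕ.* (1 ℕ.* (suc m ℕ.* suc k))
  e = trans (cong (ℕ._* suc k) (ℕP.*-identityʳ (suc m)))
        (sym (trans (ℕP.*-identityˡ _) (ℕP.*-identityˡ (suc m ℕ.* suc k))))

1/-anti : ∀ {a b} → a ℕ.≤ b → + 1 / suc b ≤ + 1 / suc a
1/-anti {a} {b} a≤b = toℚᵘ-cancel-≤ (begin
  toℚᵘ (+ 1 / suc b) ≃⟨ toℚᵘ-fromℚᵘ (ℚᵘ.mkℚᵘ (+ 1) b) ⟩
  ℚᵘ.mkℚᵘ (+ 1) b    ≤⟨ ℚᵘ.*≤* (ℤ.+≤+ (ℕP.*-monoʳ-≤ 1 (ℕ.s≤s a≤b))) ⟩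
  ℚᵘ.mkℚᵘ (+ 1) a    ≃⟨ toℚᵘ-fromℚᵘ (ℚᵘ.mkℚᵘ (+ 1) a) ⟨
  toℚᵘ (+ 1 / suc a) ∎)
  where open ℚᵘP.≤-Reasoning

0≤fromℕ : ∀ n → 0ℚ ≤ fromℕ n
0≤fromℕ zero    = ≤-refl
0≤fromℕ (suc n) = subst (0ℚ ≤_) (sym (fromℕ-suc n)) (0≤+ {1ℚ} {fromℕ n} (nonNegative⁻¹ 1ℚ) (0≤fromℕ n))

fromℕ-mono : ∀ {m n} → m ℕ.≤ n → fromℕ m ≤ fromℕ n
fromℕ-mono {n = n} ℕ.z≤n = 0≤fromℕ n
fromℕ-mono (ℕ.s≤s {m} {n} m≤n) =
  subst₂ _≤_ (sym (fromℕ-suc m)) (sym (fromℕ-suc n)) (+-monoʳ-≤ 1ℚ (fromℕ-mono m≤n))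

0<1/ : ∀ k → 0ℚ < + 1 / suc k
0<1/ k = positive⁻¹ (+ 1 / suc k) {{normalize-pos 1 (suc k)}}

archimedean : ∀ p → ∃[ N ] p ≤ fromℕ N
archimedean p@record{} = ℤ.∣ ↥ p ∣ , toℚᵘ-cancel-≤ (begin
  toℚᵘ p                      ≤⟨ ℚᵘ.*≤* le ⟩
  ℚᵘ.mkℚᵘ (+ ℤ.∣ ↥ p ∣) 0     ≃⟨ toℚᵘ-fromℚᵘ (ℚᵘ.mkℚᵘ (+ ℤ.∣ ↥ p ∣) 0) ⟨
  toℚᵘ (fromℕ ℤ.∣ ↥ p ∣)      ∎)
  where
  open ℚᵘP.≤-Reasoning
  i≤ : ∀ i d → i ℤ.* (+ 1) ℤ.≤ (+ ℤ.∣ i ∣) ℤ.* (+ suc d)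
  i≤ (+ n) d = subst₂ ℤ._≤_ (ℤP.pos-* n 1) (ℤP.pos-* n (suc d)) (ℤ.+≤+ (ℕP.*-monoʳ-≤ n (ℕ.s≤s {0} {d} ℕ.z≤n)))
  i≤ (ℤ.-[1+ n ]) d = ℤ.-≤+
  le : ℚᵘ.↥ toℚᵘ p ℤ.* (+ 1) ℤ.≤ (+ ℤ.∣ ↥ p ∣) ℤ.* ℚᵘ.↧ toℚᵘ p
  le = i≤ (↥ p) (ℚ.denominator-1 p)

archimedean-ε : ∀ C ε → 0ℚ < ε → ∃[ N ] C * (+ 1 / suc N) ≤ ε
archimedean-ε C ε 0<ε = N , (begin
  C * r                     ≡⟨ cong (_* r) C≡ ⟩
  C * 1/ε * ε * r           ≤⟨ *-monoʳ-≤-nonNeg r {{0≤r}} (*-monoʳ-≤-nonNeg ε {{nonNegative (<⇒≤ 0<ε)}} Nb) ⟩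
  fromℕ (suc N) * ε * r     ≡⟨ swap-* (fromℕ (suc N)) ε r ⟩
  r * fromℕ (suc N) * ε     ≡⟨ cong (_* ε) (1/n*n N) ⟩
  1ℚ * ε                    ≡⟨ *-identityˡ ε ⟩
  ε                         ∎)
  where
  open ≤-Reasoning
  instance
    ε≢0 : NonZero ε
    ε≢0 = >-nonZero 0<ε
  1/ε = 1/ ε
  N = proj₁ (archimedean (C * 1/ε))
  r = + 1 / suc N
  0≤r : NonNegative r
  0≤r = nonNegative (<⇒≤ (0<1/ N))
  Nb : C * 1/ε ≤ fromℕ (suc N)
  Nb = ≤-trans (proj₂ (archimedean (C * 1/ε))) (fromℕ-mono (ℕP.n≤1+n N))
  C≡ : C ≡ C * 1/ε * ε
  C≡ = sym (trans (*-assoc C 1/ε ε) (trans (cong (C *_) (*-inverseˡ ε)) (*-identityʳ C)))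

increasing : ∀ (a : ℕ → ℚ) → (∀ k → a k ≤ a (suc k)) → ∀ {m n} → m ℕ.≤ n → a m ≤ a n
increasing a step {m} m≤n = subst (λ t → a m ≤ a t) (ℕP.m∸n+n≡m m≤n) (go _)
  where
  go : ∀ k → a m ≤ a (k ℕ.+ m)
  go zero    = ≤-refl
  go (suc k) = ≤-trans (go k) (step (k ℕ.+ m))

decreasing : ∀ (a : ℕ → ℚ) → (∀ k → a (suc k) ≤ a k) → ∀ {m n} → m ℕ.≤ n → a n ≤ a m
decreasing a step {m} m≤n = subst (λ t → a t ≤ a m) (ℕP.m∸n+n≡m m≤n) (go _)
  where
  go : ∀ k → a (k ℕ.+ m) ≤ a m
  go zero    = ≤-refl
  go (suc k) = ≤-trans (step (k ℕ.+ m)) (go k)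

IsCauchy : (ℕ → ℚ) → Set
IsCauchy x = ∀ ε → 0ℚ < ε → ∃[ N ] ∀ m n → N ℕ.≤ m → N ℕ.≤ n → ∣ x m - x n ∣ ≤ ε

-- Sequences whose difference tends to 0 denote the same real number; the
-- operations and relations below respect this.
record ℝ : Set where
  field
    seq    : ℕ → ℚ
    cauchy : IsCauchy seq

open ℝ public

infix  4 _<ᴿ_ _≤ᴿ_
infixl 6 _+ᴿ_ _-ᴿ_
infixl 7 _*ᴿ_
infix  8 -ᴿ_

_<ᴿ_ : ℝ → ℝ → Set
x <ᴿ y = ∃[ δ ] 0ℚ < δ × ∃[ N ] ∀ n → N ℕ.≤ n → seq x n + δ ≤ seq y n

_≤ᴿ_ : ℝ → ℝ → Set
x ≤ᴿ y = ∀ ε → 0ℚ < ε → ∃[ N ] ∀ n → N ℕ.≤ n → seq x n ≤ seq y n + ε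

fromℚ : ℚ → ℝ
fromℚ p .seq _ = p
fromℚ p .cauchy ε 0<ε = 0 , λ _ _ _ _ → subst (λ t → ∣ t ∣ ≤ ε) (sym (+-inverseʳ p)) (<⇒≤ 0<ε)

0ℝ 1ℝ : ℝ
0ℝ = fromℚ 0ℚ
1ℝ = fromℚ 1ℚ

_+ᴿ_ : ℝ → ℝ → ℝ
(x +ᴿ y) .seq n = seq x n + seq y n
(x +ᴿ y) .cauchy ε 0<ε with cauchy x (½ * ε) (half 0<ε) | cauchy y (½ * ε) (half 0<ε)
... | N , hx | M , hy = N ℕ.⊔ M , λ m n m≥ n≥ → begin
    ∣ (seq x m + seq y m) - (seq x n + seq y n) ∣   ≡⟨ cong ∣_∣ (split-+ (seq x m) (seq y m) (seq x n) (seq y n)) ⟩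
    ∣ (seq x m - seq x n) + (seq y m - seq y n) ∣   ≤⟨ ∣p+q∣≤∣p∣+∣q∣ (seq x m - seq x n) (seq y m - seq y n) ⟩
    ∣ seq x m - seq x n ∣ + ∣ seq y m - seq y n ∣   ≤⟨ +-mono-≤
                                                        (hx m n (ℕP.m⊔n≤o⇒m≤o N M m≥) (ℕP.m⊔n≤o⇒m≤o N M n≥))
                                                        (hy m n (ℕP.m⊔n≤o⇒n≤o N M m≥) (ℕP.m⊔n≤o⇒n≤o N M n≥)) ⟩
    ½ * ε + ½ * ε                                   ≡⟨ half+half ε ⟩
    ε                                               ∎
  where open ≤-Reasoning

-ᴿ_ : ℝ → ℝ
(-ᴿ x) .seq n = - seq x n
(-ᴿ x) .cauchy ε 0<ε with cauchy x ε 0<ε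
... | N , h = N , λ m n m≥ n≥ → subst (_≤ ε)
        (trans (sym (∣-p∣≡∣p∣ (seq x m - seq x n)))
          (cong ∣_∣ (split-neg (seq x m) (seq x n))))
        (h m n m≥ n≥)

_-ᴿ_ : ℝ → ℝ → ℝ
x -ᴿ y = x +ᴿ (-ᴿ y)

bounded : ∀ x → ∃[ B ] 0ℚ ≤ B × ∃[ N ] ∀ n → N ℕ.≤ n → ∣ seq x n ∣ ≤ B
bounded x with cauchy x 1ℚ (positive⁻¹ 1ℚ)
... | N , h = 1ℚ + ∣ seq x N ∣ , 0≤+ {1ℚ} (nonNegative⁻¹ 1ℚ) (0≤∣p∣ (seq x N)) , N , λ n n≥ → begin
  ∣ seq x n ∣                          ≡⟨ cong ∣_∣ (sub-add (seq x n) (seq x N)) ⟩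
  ∣ (seq x n - seq x N) + seq x N ∣    ≤⟨ ∣p+q∣≤∣p∣+∣q∣ (seq x n - seq x N) (seq x N) ⟩
  ∣ seq x n - seq x N ∣ + ∣ seq x N ∣  ≤⟨ +-monoˡ-≤ ∣ seq x N ∣ (h n N n≥ ℕP.≤-refl) ⟩
  1ℚ + ∣ seq x N ∣                     ∎
  where open ≤-Reasoning

*-est : ∀ {p q r s A B δ η ε} → 0ℚ ≤ B → 0ℚ < η → ∣ p - r ∣ ≤ δ → ∣ q ∣ ≤ B → ∣ r ∣ ≤ A → ∣ q - s ∣ ≤ η →
  B * δ ≤ ½ * ε → A * η ≤ ½ * ε → ∣ p * q - r * s ∣ ≤ ε
*-est {p} {q} {r} {s} {A} {B} {δ} {η} {ε} 0≤B 0<η pr qB rA qs Bδ Aη = begin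
  ∣ p * q - r * s ∣                      ≤⟨ ∣pq-rs∣≤ p q r s ⟩
  ∣ p - r ∣ * ∣ q ∣ + ∣ r ∣ * ∣ q - s ∣  ≤⟨ +-mono-≤ (*-mono (0≤∣p∣ (p - r)) 0≤B pr qB)
                                                     (*-mono (0≤∣p∣ r) (<⇒≤ 0<η) rA qs) ⟩
  δ * B + A * η                          ≡⟨ cong (_+ A * η) (*-comm δ B) ⟩
  B * δ + A * η                          ≤⟨ +-mono-≤ Bδ Aη ⟩
  ½ * ε + ½ * ε                          ≡⟨ half+half ε ⟩
  ε                                      ∎
  where open ≤-Reasoning

_*ᴿ_ : ℝ → ℝ → ℝ
(x *ᴿ y) .seq n = seq x n * seq y n
(x *ᴿ y) .cauchy ε 0<ε =
  let A , 0≤A , N₁ , hA = bounded x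
      B , 0≤B , N₂ , hB = bounded y
      δ , 0<δ , Bδ≤ = shrink B 0≤B (½ * ε) (half 0<ε)
      η , 0<η , Aη≤ = shrink A 0≤A (½ * ε) (half 0<ε)
      N₃ , hx = cauchy x δ 0<δ
      N₄ , hy = cauchy y η 0<η
      l = ℕP.m⊔n≤o⇒m≤o
      r = ℕP.m⊔n≤o⇒n≤o
  in (N₁ ℕ.⊔ N₂) ℕ.⊔ (N₃ ℕ.⊔ N₄) , λ m n m≥ n≥ →
    let m₁₂ = l (N₁ ℕ.⊔ N₂) (N₃ ℕ.⊔ N₄) m≥
        m₃₄ = r (N₁ ℕ.⊔ N₂) (N₃ ℕ.⊔ N₄) m≥
        n₁₂ = l (N₁ ℕ.⊔ N₂) (N₃ ℕ.⊔ N₄) n≥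
        n₃₄ = r (N₁ ℕ.⊔ N₂) (N₃ ℕ.⊔ N₄) n≥
    in *-est {seq x m} {seq y m} {seq x n} {seq y n} 0≤B 0<η (hx m n (l N₃ N₄ m₃₄) (l N₃ N₄ n₃₄)) (hB m (r N₁ N₂ m₁₂)) (hA n (l N₁ N₂ n₁₂))
         (hy m n (r N₃ N₄ m₃₄) (r N₃ N₄ n₃₄)) Bδ≤ Aη≤

1/-close : ∀ δ a b .{{_ : Positive δ}} .{{_ : Positive a}} .{{_ : Positive b}} → δ ≤ a → δ ≤ b →
  ∣ (1/ a) {{pos⇒nonZero a}} - (1/ b) {{pos⇒nonZero b}} ∣
    ≤ (1/ δ) {{pos⇒nonZero δ}} * (1/ δ) {{pos⇒nonZero δ}} * ∣ a - b ∣
1/-close δ a b δ≤a δ≤b = begin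
  ∣ a⁻¹ - b⁻¹ ∣                    ≡⟨ cong ∣_∣ eq ⟩
  ∣ (a⁻¹ * b⁻¹) * (b - a) ∣        ≡⟨ ∣p*q∣≡∣p∣*∣q∣ (a⁻¹ * b⁻¹) (b - a) ⟩
  ∣ a⁻¹ * b⁻¹ ∣ * ∣ b - a ∣        ≡⟨ cong₂ _*_ (0≤p⇒∣p∣≡p (0≤* 0≤a⁻¹ 0≤b⁻¹)) (∣p-q∣-sym b a) ⟩
  a⁻¹ * b⁻¹ * ∣ a - b ∣            ≤⟨ *-monoʳ-≤-nonNeg ∣ a - b ∣ {{nonNegative (0≤∣p∣ (a - b))}}
                                        (*-mono 0≤a⁻¹ 0≤δ⁻¹ (inv≤ a δ≤a) (inv≤ b δ≤b)) ⟩
  δ⁻¹ * δ⁻¹ * ∣ a - b ∣            ∎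
  where
  open ≤-Reasoning
  δ⁻¹ = (1/ δ) {{pos⇒nonZero δ}}
  a⁻¹ = (1/ a) {{pos⇒nonZero a}}
  b⁻¹ = (1/ b) {{pos⇒nonZero b}}
  0≤a⁻¹ : 0ℚ ≤ a⁻¹
  0≤a⁻¹ = <⇒≤ (positive⁻¹ a⁻¹ {{1/pos⇒pos a}})
  0≤b⁻¹ : 0ℚ ≤ b⁻¹
  0≤b⁻¹ = <⇒≤ (positive⁻¹ b⁻¹ {{1/pos⇒pos b}})
  0≤δ⁻¹ : 0ℚ ≤ δ⁻¹
  0≤δ⁻¹ = <⇒≤ (positive⁻¹ δ⁻¹ {{1/pos⇒pos δ}})
  eq : a⁻¹ - b⁻¹ ≡ (a⁻¹ * b⁻¹) * (b - a)
  eq = sym (begin-equality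
    (a⁻¹ * b⁻¹) * (b - a)              ≡⟨ 1/-split a b a⁻¹ b⁻¹ ⟩
    a⁻¹ * (b⁻¹ * b) - b⁻¹ * (a⁻¹ * a)  ≡⟨ cong₂ (λ s t → a⁻¹ * s - b⁻¹ * t)
                                           (*-inverseˡ b {{pos⇒nonZero b}}) (*-inverseˡ a {{pos⇒nonZero a}}) ⟩
    a⁻¹ * 1ℚ - b⁻¹ * 1ℚ                ≡⟨ cong₂ _-_ (*-identityʳ a⁻¹) (*-identityʳ b⁻¹) ⟩
    a⁻¹ - b⁻¹                          ∎)
  inv≤ : ∀ c .{{_ : Positive c}} → δ ≤ c → (1/ c) {{pos⇒nonZero c}} ≤ δ⁻¹
  inv≤ c δ≤c = begin
    c⁻¹                ≡⟨ *-identityʳ c⁻¹ ⟨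
    c⁻¹ * 1ℚ           ≡⟨ cong (c⁻¹ *_) (*-inverseʳ δ {{pos⇒nonZero δ}}) ⟨
    c⁻¹ * (δ * δ⁻¹)    ≤⟨ *-monoˡ-≤-nonNeg c⁻¹ {{nonNegative (<⇒≤ (positive⁻¹ c⁻¹ {{1/pos⇒pos c}}))}}
                            (*-monoʳ-≤-nonNeg δ⁻¹ {{nonNegative 0≤δ⁻¹}} δ≤c) ⟩
    c⁻¹ * (c * δ⁻¹)    ≡⟨ *-assoc c⁻¹ c δ⁻¹ ⟨
    c⁻¹ * c * δ⁻¹      ≡⟨ cong (_* δ⁻¹) (*-inverseˡ c {{pos⇒nonZero c}}) ⟩
    1ℚ * δ⁻¹           ≡⟨ *-identityˡ δ⁻¹ ⟩
    δ⁻¹                ∎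
    where c⁻¹ = (1/ c) {{pos⇒nonZero c}}

⊔-pos : ∀ δ q → 0ℚ < δ → Positive (δ ⊔ q)
⊔-pos δ q 0<δ = positive (<-≤-trans 0<δ (p≤p⊔q δ q))

inv² : ∀ δ → 0ℚ < δ → ℚ
inv² δ 0<δ = (1/ δ) {{>-nonZero 0<δ}} * (1/ δ) {{>-nonZero 0<δ}}

0≤inv² : ∀ δ (0<δ : 0ℚ < δ) → 0ℚ ≤ inv² δ 0<δ
0≤inv² δ 0<δ = 0≤* 0≤δ⁻¹ 0≤δ⁻¹
  where
  0≤δ⁻¹ : 0ℚ ≤ (1/ δ) {{>-nonZero 0<δ}}
  0≤δ⁻¹ = <⇒≤ (positive⁻¹ ((1/ δ) {{>-nonZero 0<δ}}) {{1/pos⇒pos δ {{positive 0<δ}}}})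

1/⊔ : ℝ → ∀ δ → 0ℚ < δ → ℕ → ℚ
1/⊔ x δ 0<δ n = (1/ (δ ⊔ seq x n)) {{pos⇒nonZero (δ ⊔ seq x n) {{⊔-pos δ (seq x n) 0<δ}}}}

-- x is eventually at least δ, so replacing seq x n by δ ⊔ seq x n changes only
-- finitely many terms, and makes all of them invertible.
recip : ∀ x → 0ℝ <ᴿ x → ℝ
recip x (δ , 0<δ , _ , _) .seq = 1/⊔ x δ 0<δ
recip x (δ , 0<δ , N , h) .cauchy ε 0<ε =
  let η , 0<η , Cη≤ε = shrink (inv² δ 0<δ) (0≤inv² δ 0<δ) ε 0<ε
      M , hx = cauchy x η 0<η
  in N ℕ.⊔ M , λ m n m≥ n≥ → begin
    ∣ 1/⊔ x δ 0<δ m - 1/⊔ x δ 0<δ n ∣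
      ≤⟨ 1/-close δ (δ ⊔ seq x m) (δ ⊔ seq x n) {{positive 0<δ}} {{⊔-pos δ (seq x m) 0<δ}} {{⊔-pos δ (seq x n) 0<δ}}
           (p≤p⊔q δ (seq x m)) (p≤p⊔q δ (seq x n)) ⟩
    inv² δ 0<δ * ∣ (δ ⊔ seq x m) - (δ ⊔ seq x n) ∣
      ≡⟨ cong₂ (λ s t → inv² δ 0<δ * ∣ s - t ∣) (⊔≡ m (ℕP.m⊔n≤o⇒m≤o N M m≥)) (⊔≡ n (ℕP.m⊔n≤o⇒m≤o N M n≥)) ⟩
    inv² δ 0<δ * ∣ seq x m - seq x n ∣
      ≤⟨ *-monoˡ-≤-nonNeg (inv² δ 0<δ) {{nonNegative (0≤inv² δ 0<δ)}}
           (hx m n (ℕP.m⊔n≤o⇒n≤o N M m≥) (ℕP.m⊔n≤o⇒n≤o N M n≥)) ⟩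
    inv² δ 0<δ * η
      ≤⟨ Cη≤ε ⟩
    ε ∎
  where
  open ≤-Reasoning
  ⊔≡ : ∀ n → N ℕ.≤ n → δ ⊔ seq x n ≡ seq x n
  ⊔≡ n n≥ = p≤q⇒p⊔q≡q (subst (_≤ seq x n) (+-identityˡ δ) (h n n≥))

harmonic : ℕ → ℚ
harmonic zero    = 0ℚ
harmonic (suc n) = harmonic n + + 1 / suc n

-- With K = k + 1, harmonic (n K) - harmonic K = ∑_{K < j ≤ nK} 1/j is the
-- Riemann sum ∑_{K < j ≤ nK} (1/K) (1/(j/K)) of ∫₁ⁿ dt/t with mesh 1/K.
logSeq : ℕ → ℕ → ℚ
logSeq n k = harmonic (n ℕ.* suc k) - harmonic (suc k)

fromℕ-suc-* : ∀ j q → fromℕ (suc j) * q ≡ fromℕ j * q + q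
fromℕ-suc-* j q = trans (cong (_* q) (fromℕ-suc j)) (lemma (fromℕ j) q)
  where
  lemma : ∀ p q → (1ℚ + p) * q ≡ p * q + q
  lemma = solve 2 (λ p q → (con 1ℚ :+ p) :* q := p :* q :+ q) refl

harmonic-≥ : ∀ j a b → j ℕ.+ a ℕ.≤ suc b → harmonic a + fromℕ j * (+ 1 / suc b) ≤ harmonic (j ℕ.+ a)
harmonic-≥ zero a b _ = ≤-reflexive (trans (cong (λ t → harmonic a + t) (*-zeroˡ (+ 1 / suc b))) (+-identityʳ (harmonic a)))
harmonic-≥ (suc j) a b j+a≤b = begin
  harmonic a + fromℕ (suc j) * q       ≡⟨ cong (λ t → harmonic a + t) (fromℕ-suc-* j q) ⟩
  harmonic a + (fromℕ j * q + q)       ≡⟨ +-assoc (harmonic a) (fromℕ j * q) q ⟨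
  harmonic a + fromℕ j * q + q         ≤⟨ +-mono-≤ (harmonic-≥ j a b (ℕP.≤-trans (ℕP.n≤1+n (j ℕ.+ a)) j+a≤b))
                                                   (1/-anti (ℕ.s≤s⁻¹ j+a≤b)) ⟩
  harmonic (j ℕ.+ a) + + 1 / suc (j ℕ.+ a) ∎
  where
  open ≤-Reasoning
  q = + 1 / suc b

harmonic-≤ : ∀ j a → harmonic (j ℕ.+ suc a) ≤ harmonic (suc a) + fromℕ j * (+ 1 / suc a)
harmonic-≤ zero a = ≤-reflexive (sym (trans (cong (λ t → harmonic (suc a) + t) (*-zeroˡ (+ 1 / suc a))) (+-identityʳ (harmonic (suc a)))))
harmonic-≤ (suc j) a = begin
  harmonic (j ℕ.+ suc a) + + 1 / suc (j ℕ.+ suc a)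
    ≤⟨ +-mono-≤ (harmonic-≤ j a) (1/-anti (ℕP.≤-trans (ℕP.n≤1+n a) (ℕP.m≤n+m (suc a) j))) ⟩
  harmonic (suc a) + fromℕ j * q + q        ≡⟨ +-assoc (harmonic (suc a)) (fromℕ j * q) q ⟩
  harmonic (suc a) + (fromℕ j * q + q)      ≡⟨ cong (λ t → harmonic (suc a) + t) (fromℕ-suc-* j q) ⟨
  harmonic (suc a) + fromℕ (suc j) * q      ∎
  where
  open ≤-Reasoning
  q = + 1 / suc a

logSeq-increasing : ∀ m k → logSeq (suc m) k ≤ logSeq (suc m) (suc k)
logSeq-increasing m k = begin
  h - g                    ≡⟨ lemma h g q ⟩
  (h + q) - (g + q)        ≤⟨ +-monoˡ-≤ (- (g + q)) le ⟩
  h′ - (g + q)             ∎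
  where
  open ≤-Reasoning
  n = suc m
  q = + 1 / suc (suc k)
  h = harmonic (n ℕ.* suc k)
  h′ = harmonic (n ℕ.* suc (suc k))
  g = harmonic (suc k)
  lemma : ∀ h g q → h - g ≡ (h + q) - (g + q)
  lemma = solve 3 (λ h g q → h :- g := (h :+ q) :- (g :+ q)) refl
  le : h + q ≤ h′
  le = subst₂ (λ s t → h + s ≤ harmonic t) (fromℕ*1/ m (suc k)) (sym (ℕP.*-suc n (suc k)))
    (harmonic-≥ n (n ℕ.* suc k) (suc k ℕ.+ m ℕ.* suc (suc k)) (ℕP.≤-reflexive (sym (ℕP.*-suc n (suc k)))))

logSeq+1/-decreasing : ∀ m k →
  logSeq (suc m) (suc k) + + 1 / suc (suc k) ≤ logSeq (suc m) k + + 1 / suc k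
logSeq+1/-decreasing m k = begin
  (h′ - (g + q)) + q       ≡⟨ lemma₁ h′ g q ⟩
  h′ - g                   ≤⟨ +-monoˡ-≤ (- g) le ⟩
  (h + p) - g              ≡⟨ lemma₂ h g p ⟩
  (h - g) + p              ∎
  where
  open ≤-Reasoning
  n = suc m
  p = + 1 / suc k
  q = + 1 / suc (suc k)
  h = harmonic (n ℕ.* suc k)
  h′ = harmonic (n ℕ.* suc (suc k))
  g = harmonic (suc k)
  lemma₁ : ∀ h g q → (h - (g + q)) + q ≡ h - g
  lemma₁ = solve 3 (λ h g q → (h :- (g :+ q)) :+ q := h :- g) refl
  lemma₂ : ∀ h g p → (h + p) - g ≡ (h - g) + p
  lemma₂ = solve 3 (λ h g p → (h :+ p) :- g := (h :- g) :+ p) refl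
  le : h′ ≤ h + p
  le = subst₂ (λ s t → harmonic t ≤ h + s) (fromℕ*1/ m k) (sym (ℕP.*-suc n (suc k)))
    (harmonic-≤ n (k ℕ.+ m ℕ.* suc k))

logSeq-cauchy : ∀ m → IsCauchy (logSeq (suc m))
logSeq-cauchy m ε 0<ε =
  let N , 1/N≤ε = archimedean-ε 1ℚ ε 0<ε
  in N , λ i j N≤i N≤j → ≤-trans
    (∣-∣≤-both (lower N≤i) (lower N≤j) (upper N≤i) (upper N≤j))
    (subst (_≤ ε) (*-identityˡ (+ 1 / suc N)) 1/N≤ε)
  where
  lower : ∀ {N k} → N ℕ.≤ k → logSeq (suc m) N ≤ logSeq (suc m) k
  lower = increasing (logSeq (suc m)) (logSeq-increasing m)
  upper : ∀ {N k} → N ℕ.≤ k → logSeq (suc m) k ≤ logSeq (suc m) N + + 1 / suc N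
  upper {N} {k} N≤k = ≤-trans (p≤p+q (<⇒≤ (0<1/ k)))
    (decreasing (λ i → logSeq (suc m) i + + 1 / suc i) (logSeq+1/-decreasing m) N≤k)

log : (n : ℕ) .{{_ : ℕ.NonZero n}} → ℝ
log n .seq = logSeq n
log (suc m) .cauchy = logSeq-cauchy m

-- x ^ j / j !
expTerm : ℚ → ℕ → ℚ
expTerm x zero    = 1ℚ
expTerm x (suc j) = expTerm x j * (x * (+ 1 / suc j))

-- ∑_{j < k} x ^ j / j !
expSum : ℚ → ℕ → ℚ
expSum x zero    = 0ℚ
expSum x (suc k) = expSum x k + expTerm x k

0≤1/ : ∀ k → 0ℚ ≤ + 1 / suc k
0≤1/ k = <⇒≤ (0<1/ k)

∣x/n∣≤ : ∀ {x b} j → ∣ x ∣ ≤ b → ∣ x * (+ 1 / suc j) ∣ ≤ b * (+ 1 / suc j)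
∣x/n∣≤ {x} {b} j x≤b = begin
  ∣ x * c ∣     ≡⟨ ∣p*q∣≡∣p∣*∣q∣ x c ⟩
  ∣ x ∣ * ∣ c ∣ ≡⟨ cong (∣ x ∣ *_) (0≤p⇒∣p∣≡p (0≤1/ j)) ⟩
  ∣ x ∣ * c     ≤⟨ *-monoʳ-≤-nonNeg c {{nonNegative (0≤1/ j)}} x≤b ⟩
  b * c         ∎
  where
  open ≤-Reasoning
  c = + 1 / suc j

0≤expTerm : ∀ {b} → 0ℚ ≤ b → ∀ j → 0ℚ ≤ expTerm b j
0≤expTerm 0≤b zero    = nonNegative⁻¹ 1ℚ
0≤expTerm 0≤b (suc j) = 0≤* (0≤expTerm 0≤b j) (0≤* 0≤b (0≤1/ j))

∣expTerm∣≤ : ∀ {x b} → ∣ x ∣ ≤ b → ∀ j → ∣ expTerm x j ∣ ≤ expTerm b j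
∣expTerm∣≤ x≤b zero = ≤-refl
∣expTerm∣≤ {x} {b} x≤b (suc j) = begin
  ∣ expTerm x j * (x * c) ∣     ≡⟨ ∣p*q∣≡∣p∣*∣q∣ (expTerm x j) (x * c) ⟩
  ∣ expTerm x j ∣ * ∣ x * c ∣   ≤⟨ *-mono (0≤∣p∣ (expTerm x j)) (0≤* 0≤b (0≤1/ j)) (∣expTerm∣≤ x≤b j) (∣x/n∣≤ j x≤b) ⟩
  expTerm b j * (b * c)         ∎
  where
  open ≤-Reasoning
  c = + 1 / suc j
  0≤b : 0ℚ ≤ b
  0≤b = ≤-trans (0≤∣p∣ x) x≤b

∣expSum-tail∣≤ : ∀ {x b} → ∣ x ∣ ≤ b → ∀ N k →
  ∣ expSum x (k ℕ.+ N) - expSum x N ∣ ≤ expSum b (k ℕ.+ N) - expSum b N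
∣expSum-tail∣≤ {x} {b} x≤b N zero = ≤-reflexive (trans
  (cong ∣_∣ (+-inverseʳ (expSum x N))) (sym (+-inverseʳ (expSum b N))))
∣expSum-tail∣≤ {x} {b} x≤b N (suc k) = begin
  ∣ (s + t) - s₀ ∣        ≡⟨ cong ∣_∣ (swap s t s₀) ⟩
  ∣ (s - s₀) + t ∣        ≤⟨ ∣p+q∣≤∣p∣+∣q∣ (s - s₀) t ⟩
  ∣ s - s₀ ∣ + ∣ t ∣      ≤⟨ +-mono-≤ (∣expSum-tail∣≤ x≤b N k) (∣expTerm∣≤ x≤b (k ℕ.+ N)) ⟩
  (S - S₀) + T            ≡⟨ swap S T S₀ ⟨
  (S + T) - S₀            ∎
  where
  open ≤-Reasoning
  s = expSum x (k ℕ.+ N)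
  t = expTerm x (k ℕ.+ N)
  s₀ = expSum x N
  S = expSum b (k ℕ.+ N)
  T = expTerm b (k ℕ.+ N)
  S₀ = expSum b N
  swap : ∀ s t s₀ → (s + t) - s₀ ≡ (s - s₀) + t
  swap = solve 3 (λ s t s₀ → (s :+ t) :- s₀ := (s :- s₀) :+ t) refl

Lipschitz : ℚ → (ℚ → ℚ) → Set
Lipschitz b f = ∃[ ℓ ] 0ℚ ≤ ℓ × (∀ x y → ∣ x ∣ ≤ b → ∣ y ∣ ≤ b → ∣ f x - f y ∣ ≤ ℓ * ∣ x - y ∣)

const-Lipschitz : ∀ b c → Lipschitz b (λ _ → c)
const-Lipschitz b c = 0ℚ , ≤-refl , λ x y _ _ →
  ≤-reflexive (trans (cong ∣_∣ (+-inverseʳ c)) (sym (*-zeroˡ ∣ x - y ∣)))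

expTerm-Lipschitz : ∀ {b} → 0ℚ ≤ b → ∀ j → Lipschitz b (λ x → expTerm x j)
expTerm-Lipschitz {b} 0≤b zero = const-Lipschitz b 1ℚ
expTerm-Lipschitz {b} 0≤b (suc j) =
  let ℓ , 0≤ℓ , h = expTerm-Lipschitz 0≤b j
  in ℓ * (b * c) + T * c
   , 0≤+ (0≤* 0≤ℓ 0≤bc) (0≤* (0≤expTerm 0≤b j) (0≤1/ j))
   , λ x y x≤b y≤b → bound ℓ 0≤ℓ x y x≤b y≤b (h x y x≤b y≤b)
  where
  open ≤-Reasoning
  c = + 1 / suc j
  T = expTerm b j
  0≤bc : 0ℚ ≤ b * c
  0≤bc = 0≤* 0≤b (0≤1/ j)
  collect : ∀ ℓ b c T d → (ℓ * d) * (b * c) + T * (d * c) ≡ (ℓ * (b * c) + T * c) * d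
  collect = solve 5 (λ ℓ b c T d →
    (ℓ :* d) :* (b :* c) :+ T :* (d :* c) := (ℓ :* (b :* c) :+ T :* c) :* d) refl
  factor : ∀ x y c → x * c - y * c ≡ (x - y) * c
  factor = solve 3 (λ x y c → x :* c :- y :* c := (x :- y) :* c) refl
  bound : ∀ ℓ → 0ℚ ≤ ℓ → ∀ x y → ∣ x ∣ ≤ b → ∣ y ∣ ≤ b → ∣ expTerm x j - expTerm y j ∣ ≤ ℓ * ∣ x - y ∣ →
    ∣ expTerm x (suc j) - expTerm y (suc j) ∣ ≤ (ℓ * (b * c) + T * c) * ∣ x - y ∣
  bound ℓ 0≤ℓ x y x≤b y≤b h = begin
    ∣ t * (x * c) - u * (y * c) ∣                          ≤⟨ ∣pq-rs∣≤ t (x * c) u (y * c) ⟩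
    ∣ t - u ∣ * ∣ x * c ∣ + ∣ u ∣ * ∣ x * c - y * c ∣      ≡⟨ cong (λ z → ∣ t - u ∣ * ∣ x * c ∣ + ∣ u ∣ * ∣ z ∣) (factor x y c) ⟩
    ∣ t - u ∣ * ∣ x * c ∣ + ∣ u ∣ * ∣ (x - y) * c ∣
      ≤⟨ +-mono-≤ (*-mono (0≤∣p∣ (t - u)) 0≤bc h (∣x/n∣≤ j x≤b))
                  (*-mono (0≤∣p∣ u) (0≤* (0≤∣p∣ (x - y)) (0≤1/ j)) (∣expTerm∣≤ y≤b j) (∣x/n∣≤ {x - y} j ≤-refl)) ⟩
    (ℓ * ∣ x - y ∣) * (b * c) + T * (∣ x - y ∣ * c)        ≡⟨ collect ℓ b c T ∣ x - y ∣ ⟩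
    (ℓ * (b * c) + T * c) * ∣ x - y ∣                      ∎
    where
    t = expTerm x j
    u = expTerm y j

expSum-Lipschitz : ∀ {b} → 0ℚ ≤ b → ∀ k → Lipschitz b (λ x → expSum x k)
expSum-Lipschitz {b} 0≤b zero = const-Lipschitz b 0ℚ
expSum-Lipschitz {b} 0≤b (suc k) =
  let ℓ , 0≤ℓ , h = expSum-Lipschitz 0≤b k
      ℓ′ , 0≤ℓ′ , h′ = expTerm-Lipschitz 0≤b k
  in ℓ + ℓ′ , 0≤+ 0≤ℓ 0≤ℓ′ , λ x y x≤b y≤b →
    bound ℓ ℓ′ (expSum x k) (expTerm x k) (expSum y k) (expTerm y k) ∣ x - y ∣ (h x y x≤b y≤b) (h′ x y x≤b y≤b)
  where
  open ≤-Reasoning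
  bound : ∀ ℓ ℓ′ s t s′ t′ d → ∣ s - s′ ∣ ≤ ℓ * d → ∣ t - t′ ∣ ≤ ℓ′ * d →
    ∣ (s + t) - (s′ + t′) ∣ ≤ (ℓ + ℓ′) * d
  bound ℓ ℓ′ s t s′ t′ d hs ht = begin
    ∣ (s + t) - (s′ + t′) ∣    ≡⟨ cong ∣_∣ (split-+ s t s′ t′) ⟩
    ∣ (s - s′) + (t - t′) ∣    ≤⟨ ∣p+q∣≤∣p∣+∣q∣ (s - s′) (t - t′) ⟩
    ∣ s - s′ ∣ + ∣ t - t′ ∣    ≤⟨ +-mono-≤ hs ht ⟩
    ℓ * d + ℓ′ * d             ≡⟨ *-distribʳ-+ d ℓ ℓ′ ⟨
    (ℓ + ℓ′) * d               ∎

-- For j ≥ 2b each term b ^ j / j ! is at most half of the preceding one.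
expSum-tail-small : ∀ {b} → 0ℚ ≤ b → ∀ ε → 0ℚ < ε →
  ∃[ N ] ∀ m → N ℕ.≤ m → expSum b m - expSum b N ≤ ε
expSum-tail-small {b} 0≤b ε 0<ε = N , small
  where
  open ≤-Reasoning
  K = proj₁ (archimedean (b + b))
  T : ℕ → ℚ
  T i = expTerm b (i ℕ.+ K)
  S : ℕ → ℚ
  S i = expSum b (i ℕ.+ K)
  0≤T : ∀ i → 0ℚ ≤ T i
  0≤T i = 0≤expTerm 0≤b (i ℕ.+ K)

  b/n≤½ : ∀ i → b * (+ 1 / suc (i ℕ.+ K)) ≤ ½
  b/n≤½ i = begin
    b * c                   ≡⟨ double b c ⟩
    ½ * (c * (b + b))       ≤⟨ *-monoˡ-≤-nonNeg ½ (*-monoˡ-≤-nonNeg c {{nonNegative (0≤1/ (i ℕ.+ K))}}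
                                 (≤-trans (proj₂ (archimedean (b + b))) (fromℕ-mono (ℕP.m≤n+m K (suc i))))) ⟩
    ½ * (c * fromℕ (suc (i ℕ.+ K)))  ≡⟨ cong (½ *_) (1/n*n (i ℕ.+ K)) ⟩
    ½ * 1ℚ                  ≡⟨ *-identityʳ ½ ⟩
    ½                       ∎
    where
    c = + 1 / suc (i ℕ.+ K)
    double : ∀ b c → b * c ≡ ½ * (c * (b + b))
    double = solve 2 (λ b c → b :* c := con ½ :* (c :* (b :+ b))) refl

  halving : ∀ i → T (suc i) ≤ T i * ½
  halving i = *-monoˡ-≤-nonNeg (T i) {{nonNegative (0≤T i)}} (b/n≤½ i)

  decay : ∀ i → T i * fromℕ (suc i) ≤ T 0
  decay zero = ≤-reflexive (*-identityʳ (T 0))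
  decay (suc i) = begin
    T (suc i) * fromℕ (suc (suc i))        ≤⟨ *-mono (0≤T (suc i)) (0≤+ 0≤f 0≤f) (halving i) two ⟩
    T i * ½ * (f + f)                      ≡⟨ collapse (T i) f ⟩
    T i * f                                ≤⟨ decay i ⟩
    T 0                                    ∎
    where
    f = fromℕ (suc i)
    0≤f : 0ℚ ≤ f
    0≤f = 0≤fromℕ (suc i)
    two : fromℕ (suc (suc i)) ≤ f + f
    two = subst (_≤ f + f) (sym (fromℕ-suc (suc i))) (+-monoˡ-≤ f (fromℕ-mono {1} {suc i} (ℕ.s≤s ℕ.z≤n)))
    collapse : ∀ t f → t * ½ * (f + f) ≡ t * f
    collapse = solve 2 (λ t f → t :* con ½ :* (f :+ f) := t :* f) refl

  I = proj₁ (archimedean-ε (T 0 + T 0) ε 0<ε)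
  N = I ℕ.+ K

  2T≤ε : T I + T I ≤ ε
  2T≤ε = begin
    T I + T I                ≡⟨ cong₂ _+_ TI TI ⟩
    T I * f * c + T I * f * c ≡⟨ *-distribʳ-+ c (T I * f) (T I * f) ⟨
    (T I * f + T I * f) * c  ≤⟨ *-monoʳ-≤-nonNeg c {{nonNegative (0≤1/ I)}} (+-mono-≤ (decay I) (decay I)) ⟩
    (T 0 + T 0) * c          ≤⟨ proj₂ (archimedean-ε (T 0 + T 0) ε 0<ε) ⟩
    ε                        ∎
    where
    f = fromℕ (suc I)
    c = + 1 / suc I
    TI : T I ≡ T I * f * c
    TI = sym (trans (*-assoc (T I) f c) (trans (cong (T I *_) (trans (*-comm f c) (1/n*n I))) (*-identityʳ (T I))))

  step : ∀ i → S (suc i) + (T (suc i) + T (suc i)) ≤ S i + (T i + T i)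
  step i = begin
    (S i + T i) + (T (suc i) + T (suc i))  ≤⟨ +-monoʳ-≤ (S i + T i) (+-mono-≤ (halving i) (halving i)) ⟩
    (S i + T i) + (T i * ½ + T i * ½)      ≡⟨ collapse (S i) (T i) ⟩
    S i + (T i + T i)                      ∎
    where
    collapse : ∀ s t → (s + t) + (t * ½ + t * ½) ≡ s + (t + t)
    collapse = solve 2 (λ s t → (s :+ t) :+ (t :* con ½ :+ t :* con ½) := s :+ (t :+ t)) refl

  small′ : ∀ i → I ℕ.≤ i → S i - S I ≤ ε
  small′ i I≤i = begin
    S i - S I                      ≤⟨ +-monoˡ-≤ (- S I) (≤-trans (p≤p+q {S i} {T i + T i} (0≤+ (0≤T i) (0≤T i)))
                                        (decreasing (λ i → S i + (T i + T i)) step I≤i)) ⟩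
    (S I + (T I + T I)) - S I      ≡⟨ add-sub (S I) (T I + T I) ⟩
    T I + T I                      ≤⟨ 2T≤ε ⟩
    ε                              ∎

  small : ∀ m → N ℕ.≤ m → expSum b m - expSum b N ≤ ε
  small m N≤m = subst (λ t → expSum b t - expSum b N ≤ ε) (ℕP.m∸n+n≡m K≤m)
    (small′ (m ℕ.∸ K) (ℕP.m+n≤o⇒m≤o∸n I N≤m))
    where
    K≤m : K ℕ.≤ m
    K≤m = ℕP.≤-trans (ℕP.m≤n+m K I) N≤m

exp : ℝ → ℝ
exp x .seq k = expSum (seq x k) k
exp x .cauchy ε 0<ε =
  let b , 0≤b , N₁ , x≤b = bounded x
      N₂ , tail = expSum-tail-small 0≤b (½ * (½ * ε)) (half {½ * ε} (half 0<ε))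
      ℓ , 0≤ℓ , lip = expSum-Lipschitz 0≤b N₂
      δ , 0<δ , ℓδ≤ = shrink ℓ 0≤ℓ (½ * ε) (half 0<ε)
      N₃ , close = cauchy x δ 0<δ
      l = ℕP.m⊔n≤o⇒m≤o
      r = ℕP.m⊔n≤o⇒n≤o
      near : ∀ m → (N₁ ℕ.⊔ N₂) ℕ.⊔ N₃ ℕ.≤ m →
        ∣ expSum (seq x m) m - expSum (seq x m) N₂ ∣ ≤ ½ * (½ * ε)
      near m m≥ = truncate≤ (x≤b m (l N₁ N₂ (l (N₁ ℕ.⊔ N₂) N₃ m≥))) (r N₁ N₂ (l (N₁ ℕ.⊔ N₂) N₃ m≥))
        (tail m (r N₁ N₂ (l (N₁ ℕ.⊔ N₂) N₃ m≥)))
  in (N₁ ℕ.⊔ N₂) ℕ.⊔ N₃ , λ m n m≥ n≥ →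
    combine (expSum (seq x m) m) (expSum (seq x m) N₂) (expSum (seq x n) N₂) (expSum (seq x n) n)
      (near m m≥)
      (≤-trans (lip (seq x m) (seq x n) (x≤b m (l N₁ N₂ (l (N₁ ℕ.⊔ N₂) N₃ m≥))) (x≤b n (l N₁ N₂ (l (N₁ ℕ.⊔ N₂) N₃ n≥))))
        (≤-trans (*-monoˡ-≤-nonNeg ℓ {{nonNegative 0≤ℓ}} (close m n (r (N₁ ℕ.⊔ N₂) N₃ m≥) (r (N₁ ℕ.⊔ N₂) N₃ n≥))) ℓδ≤))
      (near n n≥)
  where
  open ≤-Reasoning
  truncate≤ : ∀ {y b η N m} → ∣ y ∣ ≤ b → N ℕ.≤ m → expSum b m - expSum b N ≤ η →
    ∣ expSum y m - expSum y N ∣ ≤ η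
  truncate≤ {y} {b} {η} {N} {m} y≤b N≤m h = ≤-trans
    (subst (λ t → ∣ expSum y t - expSum y N ∣ ≤ expSum b t - expSum b N) (ℕP.m∸n+n≡m N≤m)
      (∣expSum-tail∣≤ y≤b N (m ℕ.∸ N)))
    h
  quarters : ∀ ε → ½ * (½ * ε) + (½ * ε + ½ * (½ * ε)) ≡ ε
  quarters = solve 1 (λ e → con ½ :* (con ½ :* e) :+ (con ½ :* e :+ con ½ :* (con ½ :* e)) := e) refl
  combine : ∀ p q r s → ∣ p - q ∣ ≤ ½ * (½ * ε) → ∣ q - r ∣ ≤ ½ * ε → ∣ s - r ∣ ≤ ½ * (½ * ε) → ∣ p - s ∣ ≤ ε
  combine p q r s pq qr sr = begin
    ∣ p - s ∣                                    ≤⟨ ∣p-r∣≤ p q s ⟩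
    ∣ p - q ∣ + ∣ q - s ∣                        ≤⟨ +-monoʳ-≤ ∣ p - q ∣ (∣p-r∣≤ q r s) ⟩
    ∣ p - q ∣ + (∣ q - r ∣ + ∣ r - s ∣)          ≤⟨ +-mono-≤ pq (+-mono-≤ qr (subst (_≤ ½ * (½ * ε)) (∣p-q∣-sym s r) sr)) ⟩
    ½ * (½ * ε) + (½ * ε + ½ * (½ * ε))          ≡⟨ quarters ε ⟩
    ε                                            ∎

infixr 9 _^ᴿ_

_^ᴿ_ : (n : ℕ) .{{_ : ℕ.NonZero n}} → ℝ → ℝ
n ^ᴿ s = exp (s *ᴿ log n)

record ℂ : Set where
  constructor _+i_
  field
    re im : ℝ

open ℂ public

infixl 6 _+ᶜ_ _-ᶜ_
infixl 7 _·ᶜ_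
infix  4 ∣_∣<_

0ᶜ : ℂ
0ᶜ = 0ℝ +i 0ℝ

_+ᶜ_ _-ᶜ_ : ℂ → ℂ → ℂ
z +ᶜ w = (re z +ᴿ re w) +i (im z +ᴿ im w)
z -ᶜ w = (re z -ᴿ re w) +i (im z -ᴿ im w)

_·ᶜ_ : ℂ → ℝ → ℂ
z ·ᶜ a = (re z *ᴿ a) +i (im z *ᴿ a)

-- ∣ z ∣ < ε for positive ε, written as ∣ z ∣² < ε² to avoid a square root.
∣_∣<_ : ℂ → ℝ → Set
∣ z ∣< ε = re z *ᴿ re z +ᴿ im z *ᴿ im z <ᴿ ε *ᴿ ε

ArithmeticFunction : Set
ArithmeticFunction = (n : ℕ) .{{_ : ℕ.NonZero n}} → ℂ

infixl 7 _/n^_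

-- n ↦ f(n) / n ^ s, the reciprocal of n ^ s being n ^ (- s).
_/n^_ : ArithmeticFunction → ℝ → ArithmeticFunction
(f /n^ s) n = f n ·ᶜ n ^ᴿ (-ᴿ s)

∑ : ArithmeticFunction → ℕ → ℂ
∑ g zero    = 0ᶜ
∑ g (suc N) = ∑ g N +ᶜ g (suc N)

_⟶_ : (ℕ → ℂ) → ℂ → Set
a ⟶ L = ∀ ε → 0ℝ <ᴿ ε → ∃[ N ] ∀ n → N ℕ.≤ n → ∣ a n -ᶜ L ∣< ε

SeriesConverges SeriesDiverges : ArithmeticFunction → Set
SeriesConverges g = ∃[ L ] ∑ g ⟶ L
SeriesDiverges  g = ¬ SeriesConverges g

-- An integer part is not computable from a real number, so functions of x that
-- depend on it, such as ∑_{n ≤ x}, take it as an additional argument.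
Floor : ℝ → Set
Floor x = ∃[ N ] fromℚ (fromℕ N) ≤ᴿ x × x <ᴿ fromℚ (fromℕ (suc N))

∑≤ : ArithmeticFunction → (x : ℝ) → Floor x → ℂ
∑≤ g x (N , _) = ∑ g N

_is-o[x] : ((x : ℝ) → Floor x → ℂ) → Set
A is-o[x] = ∀ ε → 0ℝ <ᴿ ε → ∃[ X ] ∀ x (0<x : 0ℝ <ᴿ x) → X ≤ᴿ x → (⌊x⌋ : Floor x) →
  ∣ A x ⌊x⌋ ·ᶜ recip x 0<x ∣< ε

{-# OPTIONS --safe #-}

-- Write A(N) for the partial sums of ∑ f(n)/n^s and D(N) = A(N) - L → 0.  As
-- f(n)/n^(s-1) = n · f(n)/n^s, summation by parts gives
--   ∑_{n ≤ N} f(n)/n^(s-1) = N D(N) - ∑_{i < N} D(i),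
-- and both terms on the right are o(N).
-- The only analytic input is exp (u + log n) = n exp u.  It is obtained without
-- the addition formula, by moving from u to u + log n along the partial sums of
-- 1/(K+1) + ⋯ + 1/(nK): a step of length 1/j multiplies exp by 1 + 1/j up to
-- O(1/j²), and the product of the factors 1 + 1/j telescopes to n as K → ∞.
module Submission where

open import Defs
open import Data.Integer.Base using (+_)
open import Data.Nat.Base as ℕ using (ℕ; zero; suc)
import Data.Nat.Properties as ℕP
open import Data.Product.Base using (_,_; _×_; ∃-syntax; proj₁; proj₂)
open import Data.Rational.Base
open import Data.Rational.Properties
open import Data.Rational.Solver using (module +-*-Solver)
open import Data.Sum.Base using (inj₁; inj₂)
open import Relation.Binary.PropositionalEquality
open import Relation.Nullary using (¬_; yes; no; contradiction)

open +-*-Solver using (solve; con; _:+_; _:*_; _:-_; :-_; _:=_)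

-- Arithmetic of `fromℕ` and estimates for absolute values.

fromℕ-+ : ∀ m n → fromℕ (m ℕ.+ n) ≡ fromℕ m + fromℕ n
fromℕ-+ zero    n = sym (+-identityˡ (fromℕ n))
fromℕ-+ (suc m) n = begin
  fromℕ (suc (m ℕ.+ n))        ≡⟨ fromℕ-suc (m ℕ.+ n) ⟩
  1ℚ + fromℕ (m ℕ.+ n)         ≡⟨ cong (λ t → 1ℚ + t) (fromℕ-+ m n) ⟩
  1ℚ + (fromℕ m + fromℕ n)     ≡⟨ +-assoc 1ℚ (fromℕ m) (fromℕ n) ⟨
  1ℚ + fromℕ m + fromℕ n       ≡⟨ cong (_+ fromℕ n) (fromℕ-suc m) ⟨
  fromℕ (suc m) + fromℕ n      ∎
  where open ≡-Reasoning

fromℕ-* : ∀ m n → fromℕ (m ℕ.* n) ≡ fromℕ m * fromℕ n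
fromℕ-* zero    n = sym (*-zeroˡ (fromℕ n))
fromℕ-* (suc m) n = begin
  fromℕ (n ℕ.+ m ℕ.* n)            ≡⟨ fromℕ-+ n (m ℕ.* n) ⟩
  fromℕ n + fromℕ (m ℕ.* n)        ≡⟨ cong (λ t → fromℕ n + t) (fromℕ-* m n) ⟩
  fromℕ n + fromℕ m * fromℕ n      ≡⟨ +-comm (fromℕ n) (fromℕ m * fromℕ n) ⟩
  fromℕ m * fromℕ n + fromℕ n      ≡⟨ fromℕ-suc-* m (fromℕ n) ⟨
  fromℕ (suc m) * fromℕ n          ∎
  where open ≡-Reasoning

∣p+q∣≤ : ∀ {p q a b} → ∣ p ∣ ≤ a → ∣ q ∣ ≤ b → ∣ p + q ∣ ≤ a + b
∣p+q∣≤ {p} {q} p≤a q≤b = ≤-trans (∣p+q∣≤∣p∣+∣q∣ p q) (+-mono-≤ p≤a q≤b)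

∣p-q∣≤ : ∀ {p q a b} → ∣ p ∣ ≤ a → ∣ q ∣ ≤ b → ∣ p - q ∣ ≤ a + b
∣p-q∣≤ {p} {q} {b = b} p≤a q≤b = ∣p+q∣≤ p≤a (subst (_≤ b) (sym (∣-p∣≡∣p∣ q)) q≤b)

∣p*q∣≤ : ∀ {p q a b} → ∣ p ∣ ≤ a → ∣ q ∣ ≤ b → ∣ p * q ∣ ≤ a * b
∣p*q∣≤ {p} {q} {a} {b} p≤a q≤b = subst (_≤ a * b) (sym (∣p*q∣≡∣p∣*∣q∣ p q))
  (*-mono (0≤∣p∣ p) (≤-trans (0≤∣p∣ q) q≤b) p≤a q≤b)

-- Bounds for the terms and partial sums of the exponential series.

expSum-increasing : ∀ {b} → 0ℚ ≤ b → ∀ {m n} → m ℕ.≤ n → expSum b m ≤ expSum b n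
expSum-increasing {b} 0≤b = increasing (expSum b) λ k → p≤p+q (0≤expTerm 0≤b k)

0≤expSum : ∀ {b} → 0ℚ ≤ b → ∀ n → 0ℚ ≤ expSum b n
0≤expSum 0≤b n = expSum-increasing 0≤b (ℕ.z≤n {n})

∣expSum∣≤ : ∀ {x b} → ∣ x ∣ ≤ b → ∀ n → ∣ expSum x n ∣ ≤ expSum b n
∣expSum∣≤ x≤b zero    = ≤-refl
∣expSum∣≤ x≤b (suc n) = ∣p+q∣≤ (∣expSum∣≤ x≤b n) (∣expTerm∣≤ x≤b n)

expSum-bounded : ∀ {b} → 0ℚ ≤ b → ∃[ C ] 0ℚ ≤ C × (∀ n → expSum b n ≤ C)
expSum-bounded {b} 0≤b =
  let N , tail = expSum-tail-small 0≤b 1ℚ (positive⁻¹ 1ℚ)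
  in 1ℚ + expSum b N , 0≤+ {1ℚ} (nonNegative⁻¹ 1ℚ) (0≤expSum 0≤b N) , λ n → begin
    -- Passing to `n + N` puts every index past `N` without a case split.
    expSum b n                                  ≤⟨ expSum-increasing 0≤b (ℕP.m≤m+n n N) ⟩
    expSum b (n ℕ.+ N)                          ≡⟨ sub-add (expSum b (n ℕ.+ N)) (expSum b N) ⟩
    expSum b (n ℕ.+ N) - expSum b N + expSum b N ≤⟨ +-monoˡ-≤ (expSum b N) (tail (n ℕ.+ N) (ℕP.m≤n+m N n)) ⟩
    1ℚ + expSum b N                             ∎
  where open ≤-Reasoning

-- A term past `N` is a difference of partial sums, so the tail estimate already bounds it.
expTerm-small : ∀ {b} → 0ℚ ≤ b → ∀ ε → 0ℚ < ε → ∃[ N ] ∀ n → N ℕ.≤ n → expTerm b n ≤ ε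
expTerm-small {b} 0≤b ε 0<ε =
  let N , tail = expSum-tail-small 0≤b ε 0<ε
  in N , λ n N≤n → begin
    expTerm b n                            ≡⟨ add-sub (expSum b n) (expTerm b n) ⟨
    expSum b (suc n) - expSum b n          ≤⟨ +-monoʳ-≤ (expSum b (suc n)) (neg-antimono-≤ (expSum-increasing 0≤b N≤n)) ⟩
    expSum b (suc n) - expSum b N          ≤⟨ tail (suc n) (ℕP.≤-trans N≤n (ℕP.n≤1+n n)) ⟩
    ε                                      ∎
  where open ≤-Reasoning

-- First-order Taylor expansion of the partial exponential sums.

-- The derivative of x ^ (j + 1) / (j + 1) ! is x ^ j / j !.
expTerm-remainder : ℚ → ℚ → ℕ → ℚ
expTerm-remainder v h j = expTerm (v + h) (suc j) - expTerm v (suc j) - h * expTerm v j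

expTerm-suc : ∀ x j → fromℕ (suc j) * expTerm x (suc j) ≡ expTerm x j * x
expTerm-suc x j = begin
  n * (t * (x * c))   ≡⟨ lemma n t x c ⟩
  c * n * (t * x)     ≡⟨ cong (_* (t * x)) (1/n*n j) ⟩
  1ℚ * (t * x)        ≡⟨ *-identityˡ (t * x) ⟩
  t * x               ∎
  where
  open ≡-Reasoning
  n = fromℕ (suc j)
  t = expTerm x j
  c = + 1 / suc j
  lemma : ∀ n t x c → n * (t * (x * c)) ≡ c * n * (t * x)
  lemma = solve 4 (λ n t x c → n :* (t :* (x :* c)) := c :* n :* (t :* x)) refl

-- Writing the last `T` as `c * (1 + n) * T` makes `c` a common factor, and `n * T = t * v` lowers
-- the order. The recurrence is what the induction on remainders runs on.
expTerm-remainder-suc : ∀ v h j → expTerm-remainder v h (suc j)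
  ≡ (+ 1 / suc (suc j)) * (h * h * expTerm v j + expTerm-remainder v h j * (v + h))
expTerm-remainder-suc v h j = begin
  T′ * ((v + h) * c) - T * (v * c) - h * T
    ≡⟨ cong (λ z → T′ * ((v + h) * c) - T * (v * c) - h * z) (trans (sym (*-identityˡ T)) (cong (_* T) (sym c[1+n]))) ⟩
  T′ * ((v + h) * c) - T * (v * c) - h * (c * (1ℚ + n) * T)
    ≡⟨ lemma₁ T T′ v h c n ⟩
  c * (T′ * (v + h) - T * v - h * T - h * (n * T))
    ≡⟨ cong (λ z → c * (T′ * (v + h) - T * v - h * T - h * z)) (expTerm-suc v j) ⟩
  c * (T′ * (v + h) - T * v - h * T - h * (t * v))
    ≡⟨ lemma₂ t T T′ v h c ⟩
  c * (h * h * t + (T′ - T - h * t) * (v + h)) ∎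
  where
  open ≡-Reasoning
  t = expTerm v j
  T = expTerm v (suc j)
  T′ = expTerm (v + h) (suc j)
  n = fromℕ (suc j)
  c = + 1 / suc (suc j)
  c[1+n] : c * (1ℚ + n) ≡ 1ℚ
  c[1+n] = trans (cong (c *_) (sym (fromℕ-suc (suc j)))) (1/n*n (suc j))
  lemma₁ : ∀ T T′ v h c n → T′ * ((v + h) * c) - T * (v * c) - h * (c * (1ℚ + n) * T)
    ≡ c * (T′ * (v + h) - T * v - h * T - h * (n * T))
  lemma₁ = solve 6 (λ T T′ v h c n →
    T′ :* ((v :+ h) :* c) :- T :* (v :* c) :- h :* (c :* (con 1ℚ :+ n) :* T)
    := c :* (T′ :* (v :+ h) :- T :* v :- h :* T :- h :* (n :* T))) refl
  lemma₂ : ∀ t T T′ v h c → c * (T′ * (v + h) - T * v - h * T - h * (t * v))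
    ≡ c * (h * h * t + (T′ - T - h * t) * (v + h))
  lemma₂ = solve 6 (λ t T T′ v h c →
    c :* (T′ :* (v :+ h) :- T :* v :- h :* T :- h :* (t :* v))
    := c :* (h :* h :* t :+ (T′ :- T :- h :* t) :* (v :+ h))) refl

expTerm-remainder-zero : ∀ v h → expTerm-remainder v h 0 ≡ 0ℚ
expTerm-remainder-zero = solve 2 (λ v h →
  con 1ℚ :* ((v :+ h) :* con 1ℚ) :- con 1ℚ :* (v :* con 1ℚ) :- h :* con 1ℚ := con 0ℚ) refl

-- In the recurrence the term with `h * h` contributes one copy of `∣h∣² * T` and the previous
-- remainder `j` copies, because `expTerm b i * b` is `i + 1` times the next term. The factor
-- `c = 1 / (j + 2)` outweighs these `j + 1` copies.
∣expTerm-remainder∣≤ : ∀ {b v h} → ∣ v ∣ ≤ b → ∣ v + h ∣ ≤ b → ∀ j →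
  ∣ expTerm-remainder v h (suc j) ∣ ≤ ∣ h ∣ * ∣ h ∣ * expTerm b j
∣expTerm-remainder∣≤ {b} {v} {h} v≤b v+h≤b j = begin
  ∣ expTerm-remainder v h (suc j) ∣    ≡⟨ cong ∣_∣ (expTerm-remainder-suc v h j) ⟩
  ∣ c * (h * h * expTerm v j + expTerm-remainder v h j * (v + h)) ∣
    ≤⟨ ∣p*q∣≤ {c} (≤-reflexive (0≤p⇒∣p∣≡p (0≤1/ (suc j))))
         (∣p+q∣≤ (∣p*q∣≤ (∣p*q∣≤ {h} {h} ≤-refl ≤-refl) (∣expTerm∣≤ v≤b j)) (∣R[v+h]∣≤ j)) ⟩
  c * (∣h∣² * T + fromℕ j * (∣h∣² * T))    ≡⟨ cong (c *_) (trans (+-comm (∣h∣² * T) _) (sym (fromℕ-suc-* j (∣h∣² * T)))) ⟩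
  c * (fromℕ (suc j) * (∣h∣² * T))
    ≤⟨ *-monoˡ-≤-nonNeg c {{nonNegative (0≤1/ (suc j))}}
         (*-monoʳ-≤-nonNeg (∣h∣² * T) {{nonNegative (0≤* (0≤* (0≤∣p∣ h) (0≤∣p∣ h)) 0≤T)}} (fromℕ-mono (ℕP.n≤1+n (suc j)))) ⟩
  c * (fromℕ (suc (suc j)) * (∣h∣² * T))   ≡⟨ *-assoc c (fromℕ (suc (suc j))) (∣h∣² * T) ⟨
  c * fromℕ (suc (suc j)) * (∣h∣² * T)     ≡⟨ cong (_* (∣h∣² * T)) (1/n*n (suc j)) ⟩
  1ℚ * (∣h∣² * T)                         ≡⟨ *-identityˡ (∣h∣² * T) ⟩
  ∣h∣² * T                                ∎
  where
  open ≤-Reasoning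
  c = + 1 / suc (suc j)
  ∣h∣² = ∣ h ∣ * ∣ h ∣
  T = expTerm b j
  0≤b : 0ℚ ≤ b
  0≤b = ≤-trans (0≤∣p∣ v) v≤b
  0≤T : 0ℚ ≤ T
  0≤T = 0≤expTerm 0≤b j
  shift : ∀ a n t → a * (n * t) ≡ n * (a * t)
  shift = solve 3 (λ a n t → a :* (n :* t) := n :* (a :* t)) refl
  ∣R[v+h]∣≤ : ∀ i → ∣ expTerm-remainder v h i * (v + h) ∣ ≤ fromℕ i * (∣ h ∣ * ∣ h ∣ * expTerm b i)
  ∣R[v+h]∣≤ zero = ≤-reflexive (trans
    (cong ∣_∣ (trans (cong (_* (v + h)) (expTerm-remainder-zero v h)) (*-zeroˡ (v + h))))
    (sym (*-zeroˡ (∣ h ∣ * ∣ h ∣ * 1ℚ))))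
  ∣R[v+h]∣≤ (suc i) = begin
    ∣ expTerm-remainder v h (suc i) * (v + h) ∣   ≤⟨ ∣p*q∣≤ (∣expTerm-remainder∣≤ v≤b v+h≤b i) v+h≤b ⟩
    ∣h∣² * expTerm b i * b                        ≡⟨ *-assoc ∣h∣² (expTerm b i) b ⟩
    ∣h∣² * (expTerm b i * b)                      ≡⟨ cong (∣h∣² *_) (expTerm-suc b i) ⟨
    ∣h∣² * (fromℕ (suc i) * expTerm b (suc i))    ≡⟨ shift ∣h∣² (fromℕ (suc i)) (expTerm b (suc i)) ⟩
    fromℕ (suc i) * (∣h∣² * expTerm b (suc i))    ∎

-- Differentiating a partial sum drops its last term, so the linear part has one term fewer. The
-- error is the sum of the termwise remainders.
expSum-taylor : ∀ {b v h} → ∣ v ∣ ≤ b → ∣ v + h ∣ ≤ b → ∀ i →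
  ∣ expSum (v + h) (suc (suc i)) - expSum v (suc (suc i)) - h * expSum v (suc i) ∣
    ≤ ∣ h ∣ * ∣ h ∣ * expSum b i
expSum-taylor {b} {v} {h} v≤b v+h≤b zero = ≤-reflexive (trans
  (cong ∣_∣ (lemma v h)) (sym (*-zeroʳ (∣ h ∣ * ∣ h ∣))))
  where
  lemma : ∀ v h → expSum (v + h) 2 - expSum v 2 - h * expSum v 1 ≡ 0ℚ
  lemma = solve 2 (λ v h →
    (con 0ℚ :+ con 1ℚ :+ con 1ℚ :* ((v :+ h) :* con 1ℚ)) :- (con 0ℚ :+ con 1ℚ :+ con 1ℚ :* (v :* con 1ℚ))
    :- h :* (con 0ℚ :+ con 1ℚ) := con 0ℚ) refl
expSum-taylor {b} {v} {h} v≤b v+h≤b (suc i) = begin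
  ∣ (S′ + T′) - (S + T) - h * (s + t) ∣         ≡⟨ cong ∣_∣ (lemma S′ T′ S T h s t) ⟩
  ∣ (S′ - S - h * s) + (T′ - T - h * t) ∣       ≤⟨ ∣p+q∣≤ (expSum-taylor v≤b v+h≤b i) (∣expTerm-remainder∣≤ v≤b v+h≤b i) ⟩
  ∣ h ∣ * ∣ h ∣ * expSum b i + ∣ h ∣ * ∣ h ∣ * expTerm b i
                                                ≡⟨ *-distribˡ-+ (∣ h ∣ * ∣ h ∣) (expSum b i) (expTerm b i) ⟨
  ∣ h ∣ * ∣ h ∣ * expSum b (suc i)              ∎
  where
  open ≤-Reasoning
  S′ = expSum (v + h) (suc (suc i))
  T′ = expTerm (v + h) (suc (suc i))
  S = expSum v (suc (suc i))
  T = expTerm v (suc (suc i))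
  s = expSum v (suc i)
  t = expTerm v (suc i)
  lemma : ∀ S′ T′ S T h s t →
    (S′ + T′) - (S + T) - h * (s + t) ≡ (S′ - S - h * s) + (T′ - T - h * t)
  lemma = solve 7 (λ S′ T′ S T h s t →
    (S′ :+ T′) :- (S :+ T) :- h :* (s :+ t) := (S′ :- S :- h :* s) :+ (T′ :- T :- h :* t)) refl

-- A truncated sum is not its own derivative: completing the shorter sum of `expSum-taylor` costs
-- its missing top term, hence the second summand of the bound.
expSum-step : ∀ {b v h} → ∣ v ∣ ≤ b → ∣ v + h ∣ ≤ b → ∀ i →
  ∣ expSum (v + h) (suc (suc i)) - (1ℚ + h) * expSum v (suc (suc i)) ∣
    ≤ ∣ h ∣ * ∣ h ∣ * expSum b i + ∣ h ∣ * expTerm b (suc i)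
expSum-step {b} {v} {h} v≤b v+h≤b i = begin
  ∣ S′ - (1ℚ + h) * (s + t) ∣                    ≡⟨ cong ∣_∣ (lemma S′ h s t) ⟩
  ∣ (S′ - (s + t) - h * s) - h * t ∣             ≤⟨ ∣p-q∣≤ (expSum-taylor v≤b v+h≤b i) (∣p*q∣≤ {h} ≤-refl (∣expTerm∣≤ v≤b (suc i))) ⟩
  ∣ h ∣ * ∣ h ∣ * expSum b i + ∣ h ∣ * expTerm b (suc i) ∎
  where
  open ≤-Reasoning
  S′ = expSum (v + h) (suc (suc i))
  s = expSum v (suc i)
  t = expTerm v (suc i)
  lemma : ∀ S′ h s t → S′ - (1ℚ + h) * (s + t) ≡ (S′ - (s + t) - h * s) - h * t
  lemma = solve 4 (λ S′ h s t →
    S′ :- (con 1ℚ :+ h) :* (s :+ t) := (S′ :- (s :+ t) :- h :* s) :- h :* t) refl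

-- Products of the factors 1 + 1/j and the shift by `logSeq`.

-- As 1 + 1/n = (n + 1)/n, the case d = 0 of the recurrence telescopes to
-- (a + 1) · e J = (J + a + 1) · e 0.
telescoping-product : ∀ (e : ℕ → ℚ) a d → 0ℚ ≤ d → ∀ J →
  (∀ j → j ℕ.< J → ∣ e (suc j) - (1ℚ + (+ 1 / suc (j ℕ.+ a))) * e j ∣ ≤ d) →
  ∣ fromℕ (suc a) * e J - fromℕ (suc (J ℕ.+ a)) * e 0 ∣ ≤ fromℕ J * fromℕ (suc (J ℕ.+ a)) * d
telescoping-product e a d 0≤d zero step = ≤-reflexive (trans
  (cong ∣_∣ (+-inverseʳ (fromℕ (suc a) * e 0)))
  (sym (trans (cong (_* d) (*-zeroˡ (fromℕ (suc a)))) (*-zeroˡ d))))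
telescoping-product e a d 0≤d (suc j) step = begin
  ∣ w₀ * e (suc j) - w′ * e 0 ∣
    ≡⟨ cong (λ z → ∣ w₀ * e (suc j) - z * e 0 ∣) w′≡ ⟩
  ∣ w₀ * e (suc j) - (1ℚ + h) * w * e 0 ∣
    ≡⟨ cong ∣_∣ (split w₀ (e (suc j)) h w (e 0) (e j)) ⟩
  ∣ (1ℚ + h) * (w₀ * e j - w * e 0) + w₀ * (e (suc j) - (1ℚ + h) * e j) ∣
    ≤⟨ ∣p+q∣≤ (∣p*q∣≤ {1ℚ + h} (≤-reflexive (0≤p⇒∣p∣≡p (0≤+ {1ℚ} (nonNegative⁻¹ 1ℚ) (0≤1/ (j ℕ.+ a)))))
                (telescoping-product e a d 0≤d j (λ i i<j → step i (ℕP.m<n⇒m<1+n i<j))))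
              (∣p*q∣≤ {w₀} (≤-reflexive (0≤p⇒∣p∣≡p (0≤fromℕ (suc a)))) (step j ℕP.≤-refl)) ⟩
  (1ℚ + h) * (fromℕ j * w * d) + w₀ * d
    ≡⟨ cong (_+ w₀ * d) (regroup h (fromℕ j) w d) ⟩
  fromℕ j * ((1ℚ + h) * w * d) + w₀ * d
    ≡⟨ cong (λ z → fromℕ j * (z * d) + w₀ * d) w′≡ ⟨
  fromℕ j * (w′ * d) + w₀ * d
    -- `w₀` is enlarged to `w′` so that the new error joins the `j` earlier ones with the same
    -- coefficient.
    ≤⟨ +-monoʳ-≤ (fromℕ j * (w′ * d)) (*-monoʳ-≤-nonNeg d {{nonNegative 0≤d}} (fromℕ-mono (ℕ.s≤s (ℕP.m≤n+m a (suc j))))) ⟩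
  fromℕ j * (w′ * d) + w′ * d
    ≡⟨ fromℕ-suc-* j (w′ * d) ⟨
  fromℕ (suc j) * (w′ * d)
    ≡⟨ *-assoc (fromℕ (suc j)) w′ d ⟨
  fromℕ (suc j) * w′ * d ∎
  where
  open ≤-Reasoning
  h = + 1 / suc (j ℕ.+ a)
  w₀ = fromℕ (suc a)
  w = fromℕ (suc (j ℕ.+ a))
  w′ = fromℕ (suc (suc (j ℕ.+ a)))
  w′≡ : w′ ≡ (1ℚ + h) * w
  w′≡ = trans (fromℕ-suc (suc (j ℕ.+ a))) (trans (cong (_+ w) (sym (1/n*n (j ℕ.+ a)))) (collect h w))
    where
    collect : ∀ h w → h * w + w ≡ (1ℚ + h) * w
    collect = solve 2 (λ h w → h :* w :+ w := (con 1ℚ :+ h) :* w) refl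
  split : ∀ w₀ e′ h w e₀ e → w₀ * e′ - (1ℚ + h) * w * e₀
    ≡ (1ℚ + h) * (w₀ * e - w * e₀) + w₀ * (e′ - (1ℚ + h) * e)
  split = solve 6 (λ w₀ e′ h w e₀ e → w₀ :* e′ :- (con 1ℚ :+ h) :* w :* e₀
    := (con 1ℚ :+ h) :* (w₀ :* e :- w :* e₀) :+ w₀ :* (e′ :- (con 1ℚ :+ h) :* e)) refl
  regroup : ∀ h j w d → (1ℚ + h) * (j * w * d) ≡ j * ((1ℚ + h) * w * d)
  regroup = solve 4 (λ h j w d → (con 1ℚ :+ h) :* (j :* w :* d) := j :* ((con 1ℚ :+ h) :* w :* d)) refl

harmonic-mono : ∀ {m n} → m ℕ.≤ n → harmonic m ≤ harmonic n
harmonic-mono = increasing harmonic λ k → p≤p+q (0≤1/ k)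

-- Here n = m + 1 and K = k + 1, so that logSeq n k = 1/(K + 1) + ⋯ + 1/(n K).
expSum-+logSeq : ∀ m i {u p l C} → let k = suc (suc i) in
  0ℚ ≤ p → ∣ u ∣ ≤ p → logSeq (suc m) k ≤ l → (∀ j → expSum (p + l) j ≤ C) →
  ∣ expSum (u + logSeq (suc m) k) k - fromℕ (suc m) * expSum u k ∣
    ≤ (fromℕ m * fromℕ (suc m) * C + fromℕ m * C) * (+ 1 / suc k)
      + fromℕ m * fromℕ (suc m) * expTerm (p + l) (suc i)
expSum-+logSeq m i {u} {p} {l} {C} 0≤p u≤p l≤ E≤C = *-cancelˡ-≤-pos w₀ {{positive 0<w₀}} (begin
  -- The telescoped product compares `w₀ * e r` with `w * e 0`, so the inequality is proved
  -- multiplied by `w₀ = K + 1`.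
  w₀ * ∣ expSum (u + logSeq n k) k - N * E₀ ∣
    ≡⟨ cong (λ z → w₀ * ∣ expSum (u + (harmonic z - harmonic a)) k - N * E₀ ∣) (ℕP.+-comm a r) ⟩
  w₀ * ∣ e r - N * E₀ ∣
    ≡⟨ cong (_* ∣ e r - N * E₀ ∣) (sym (0≤p⇒∣p∣≡p (<⇒≤ 0<w₀))) ⟩
  ∣ w₀ ∣ * ∣ e r - N * E₀ ∣
    ≡⟨ ∣p*q∣≡∣p∣*∣q∣ w₀ (e r - N * E₀) ⟨
  ∣ w₀ * (e r - N * E₀) ∣
    ≡⟨ cong ∣_∣ eq ⟩
  ∣ (w₀ * e r - w * e 0) - M * e 0 ∣
    ≤⟨ ∣p-q∣≤ (telescoping-product e a d 0≤d r step)
              (∣p*q∣≤ {M} (≤-reflexive (0≤p⇒∣p∣≡p (0≤fromℕ m))) e₀≤C) ⟩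
  fromℕ r * w * d + M * C
    ≤⟨ +-mono-≤ (*-monoʳ-≤-nonNeg d {{nonNegative 0≤d}} (*-monoˡ-≤-nonNeg (fromℕ r) {{nonNegative (0≤fromℕ r)}} w≤))
                (subst (_≤ M * C * (q * w₀)) (*-identityʳ (M * C)) (*-monoˡ-≤-nonNeg (M * C) {{nonNegative 0≤MC}} 1≤qw₀)) ⟩
  fromℕ r * (N * w₀) * d + M * C * (q * w₀)
    ≡⟨ cong (λ z → z * (N * w₀) * d + M * C * (q * w₀)) (fromℕ-* m a) ⟩
  M * A * (N * w₀) * d + M * C * (q * w₀)
    ≡⟨ regroup M A N w₀ q C t ⟩
  -- The `M * A` steps use up one factor `q`, since `q * A = 1`; a factor `q * C + t` remains to
  -- make the error small.
  w₀ * (M * N * (q * A) * (q * C + t) + M * C * q)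
    ≡⟨ cong (λ z → w₀ * (M * N * z * (q * C + t) + M * C * q)) (1/n*n k) ⟩
  w₀ * (M * N * 1ℚ * (q * C + t) + M * C * q)
    ≡⟨ cong (w₀ *_) (collect M N C q t) ⟩
  w₀ * ((M * N * C + M * C) * q + M * N * t) ∎)
  where
  open ≤-Reasoning
  k = suc (suc i)
  n = suc m
  a = suc k
  r = m ℕ.* a
  b = p + l
  M = fromℕ m
  N = fromℕ n
  A = fromℕ a
  q = + 1 / suc k
  t = expTerm b (suc i)
  E₀ = expSum u k
  w₀ = fromℕ (suc a)
  w = fromℕ (suc (r ℕ.+ a))
  -- The error of `expSum-step` made uniform: every step length 1/(K+1), ..., 1/(nK) is at most
  -- `q = 1/K`.
  d = q * q * C + q * t
  v : ℕ → ℚ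
  v j = u + (harmonic (j ℕ.+ a) - harmonic a)
  e : ℕ → ℚ
  e j = expSum (v j) k

  0≤l : 0ℚ ≤ l
  0≤l = ≤-trans (subst (_≤ logSeq n k) (+-inverseʳ (harmonic a)) (+-monoˡ-≤ (- harmonic a) (harmonic-mono (ℕP.m≤m+n a r)))) l≤
  0≤b : 0ℚ ≤ b
  0≤b = 0≤+ 0≤p 0≤l
  0≤C : 0ℚ ≤ C
  0≤C = ≤-trans (0≤expSum 0≤b 0) (E≤C 0)
  0≤t : 0ℚ ≤ t
  0≤t = 0≤expTerm 0≤b (suc i)
  0≤q : 0ℚ ≤ q
  0≤q = 0≤1/ k
  0≤MC : 0ℚ ≤ M * C
  0≤MC = 0≤* (0≤fromℕ m) 0≤C
  0≤d : 0ℚ ≤ d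
  0≤d = 0≤+ (0≤* (0≤* 0≤q 0≤q) 0≤C) (0≤* 0≤q 0≤t)
  0<w₀ : 0ℚ < w₀
  0<w₀ = <-≤-trans (positive⁻¹ 1ℚ) (fromℕ-mono {1} {suc a} (ℕ.s≤s ℕ.z≤n))

  v≤b : ∀ j → j ℕ.≤ r → ∣ v j ∣ ≤ b
  v≤b j j≤r = ∣p+q∣≤ u≤p (begin
    ∣ harmonic (j ℕ.+ a) - harmonic a ∣
      ≡⟨ 0≤p⇒∣p∣≡p (subst (_≤ harmonic (j ℕ.+ a) - harmonic a) (+-inverseʳ (harmonic a))
           (+-monoˡ-≤ (- harmonic a) (harmonic-mono (ℕP.m≤n+m a j)))) ⟩
    harmonic (j ℕ.+ a) - harmonic a
      ≤⟨ +-monoˡ-≤ (- harmonic a) (harmonic-mono (subst (j ℕ.+ a ℕ.≤_) (ℕP.+-comm r a) (ℕP.+-monoˡ-≤ a j≤r))) ⟩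
    logSeq n k
      ≤⟨ l≤ ⟩
    l ∎)

  v-suc : ∀ j → v (suc j) ≡ v j + + 1 / suc (j ℕ.+ a)
  v-suc j = lemma u (harmonic (j ℕ.+ a)) (+ 1 / suc (j ℕ.+ a)) (harmonic a)
    where
    lemma : ∀ u x h y → u + ((x + h) - y) ≡ (u + (x - y)) + h
    lemma = solve 4 (λ u x h y → u :+ ((x :+ h) :- y) := (u :+ (x :- y)) :+ h) refl

  step : ∀ j → j ℕ.< r → ∣ e (suc j) - (1ℚ + (+ 1 / suc (j ℕ.+ a))) * e j ∣ ≤ d
  step j j<r = begin
    ∣ e (suc j) - (1ℚ + h) * e j ∣
      ≡⟨ cong (λ z → ∣ expSum z k - (1ℚ + h) * e j ∣) (v-suc j) ⟩
    ∣ expSum (v j + h) k - (1ℚ + h) * e j ∣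
      ≤⟨ expSum-step {h = h} (v≤b j (ℕP.<⇒≤ j<r)) (subst (λ z → ∣ z ∣ ≤ b) (v-suc j) (v≤b (suc j) j<r)) i ⟩
    ∣ h ∣ * ∣ h ∣ * expSum b i + ∣ h ∣ * t
      ≤⟨ +-mono-≤ (*-mono (0≤* (0≤∣p∣ h) (0≤∣p∣ h)) 0≤C (*-mono (0≤∣p∣ h) 0≤q h≤q h≤q) (E≤C i))
                  (*-monoʳ-≤-nonNeg t {{nonNegative 0≤t}} h≤q) ⟩
    d ∎
    where
    h = + 1 / suc (j ℕ.+ a)
    h≤q : ∣ h ∣ ≤ q
    h≤q = subst (_≤ q) (sym (0≤p⇒∣p∣≡p (0≤1/ (j ℕ.+ a)))) (1/-anti (ℕP.≤-trans (ℕP.n≤1+n k) (ℕP.m≤n+m a j)))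

  v0≡u : v 0 ≡ u
  v0≡u = trans (cong (λ z → u + z) (+-inverseʳ (harmonic a))) (+-identityʳ u)

  e₀≤C : ∣ e 0 ∣ ≤ C
  e₀≤C = ≤-trans (∣expSum∣≤ (v≤b 0 ℕ.z≤n) k) (E≤C k)

  -- The product ends at nK + 1 instead of n(K + 1); the shortfall `M = n - 1` becomes the separate
  -- term `M * e 0` in `eq`.
  w≡ : w ≡ N * w₀ - M
  w≡ = begin-equality
    fromℕ (suc (r ℕ.+ a))        ≡⟨ fromℕ-suc (r ℕ.+ a) ⟩
    1ℚ + fromℕ (r ℕ.+ a)         ≡⟨ cong (λ z → 1ℚ + z) (trans (fromℕ-+ r a) (cong (_+ A) (fromℕ-* m a))) ⟩
    1ℚ + (M * A + A)             ≡⟨ lemma M A ⟩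
    (1ℚ + M) * (1ℚ + A) - M      ≡⟨ cong₂ (λ x y → x * y - M) (fromℕ-suc m) (fromℕ-suc a) ⟨
    N * w₀ - M                   ∎
    where
    lemma : ∀ M A → 1ℚ + (M * A + A) ≡ (1ℚ + M) * (1ℚ + A) - M
    lemma = solve 2 (λ M A → con 1ℚ :+ (M :* A :+ A) := (con 1ℚ :+ M) :* (con 1ℚ :+ A) :- M) refl

  w≤ : w ≤ N * w₀
  w≤ = subst₂ _≤_ (sym w≡) (+-identityʳ (N * w₀)) (+-monoʳ-≤ (N * w₀) (neg-antimono-≤ (0≤fromℕ m)))

  1≤qw₀ : 1ℚ ≤ q * w₀
  1≤qw₀ = subst (_≤ q * w₀) (1/n*n k) (*-monoˡ-≤-nonNeg q {{nonNegative 0≤q}} (fromℕ-mono (ℕP.n≤1+n a)))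

  eq : w₀ * (e r - N * E₀) ≡ (w₀ * e r - w * e 0) - M * e 0
  eq = begin-equality
    w₀ * (e r - N * E₀)                            ≡⟨ cong (λ z → w₀ * (e r - N * expSum z k)) v0≡u ⟨
    w₀ * (e r - N * e 0)                           ≡⟨ lemma w₀ (e r) N (e 0) M ⟩
    (w₀ * e r - (N * w₀ - M) * e 0) - M * e 0      ≡⟨ cong (λ z → (w₀ * e r - z * e 0) - M * e 0) w≡ ⟨
    (w₀ * e r - w * e 0) - M * e 0                 ∎
    where
    lemma : ∀ w₀ x N y M → w₀ * (x - N * y) ≡ (w₀ * x - (N * w₀ - M) * y) - M * y
    lemma = solve 5 (λ w₀ x N y M → w₀ :* (x :- N :* y) := (w₀ :* x :- (N :* w₀ :- M) :* y) :- M :* y) refl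

  regroup : ∀ M A N w₀ q C t → M * A * (N * w₀) * (q * q * C + q * t) + M * C * (q * w₀)
    ≡ w₀ * (M * N * (q * A) * (q * C + t) + M * C * q)
  regroup = solve 7 (λ M A N w₀ q C t → M :* A :* (N :* w₀) :* (q :* q :* C :+ q :* t) :+ M :* C :* (q :* w₀)
    := w₀ :* (M :* N :* (q :* A) :* (q :* C :+ t) :+ M :* C :* q)) refl
  collect : ∀ M N C q t → M * N * 1ℚ * (q * C + t) + M * C * q ≡ (M * N * C + M * C) * q + M * N * t
  collect = solve 5 (λ M N C q t → M :* N :* con 1ℚ :* (q :* C :+ t) :+ M :* C :* q
    := (M :* N :* C :+ M :* C) :* q :+ M :* N :* t) refl

-- Null sequences and the identity exp (u + log n) = n exp u.

Eventually : (ℕ → Set) → Set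
Eventually P = ∃[ N ] ∀ n → N ℕ.≤ n → P n

infixr 6 _∩_
_∩_ : ∀ {P Q} → Eventually P → Eventually Q → Eventually (λ n → P n × Q n)
(N , p) ∩ (M , q) = N ℕ.⊔ M , λ n n≥ → p n (ℕP.m⊔n≤o⇒m≤o N M n≥) , q n (ℕP.m⊔n≤o⇒n≤o N M n≥)

eventually-map : ∀ {P Q} → (∀ n → P n → Q n) → Eventually P → Eventually Q
eventually-map f (N , p) = N , λ n n≥ → f n (p n n≥)

eventually-≥ : ∀ m → Eventually (m ℕ.≤_)
eventually-≥ m = m , λ _ m≤n → m≤n

infix 4 _→0
-- Applied to the difference of two sequences representing reals, this is equality of those reals.
_→0 : (ℕ → ℚ) → Set
x →0 = ∀ ε → 0ℚ < ε → Eventually (λ k → ∣ x k ∣ ≤ ε)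

-- The error in `expSum-+logSeq` is a multiple of 1/K plus a multiple of an exponential term at
-- `p + l`. With `p` and `l` bounding the approximations of `u` and `log n`, each part is eventually
-- at most ε/2.
exp-+log : ∀ u m → (λ k → seq (exp (u +ᴿ log (suc m))) k - fromℕ (suc m) * seq (exp u) k) →0
exp-+log u m ε 0<ε =
  let p , 0≤p , u≤p = bounded u
      l , 0≤l , l≤l = bounded (log (suc m))
      C , 0≤C , E≤C = expSum-bounded (0≤+ 0≤p 0≤l)
      c = fromℕ m * fromℕ (suc m)
      D = c * C + fromℕ m * C
      0≤c = 0≤* (0≤fromℕ m) (0≤fromℕ (suc m))
      0≤D = 0≤+ (0≤* 0≤c 0≤C) (0≤* (0≤fromℕ m) 0≤C)
      δ , 0<δ , cδ≤ = shrink c 0≤c (½ * ε) (half 0<ε)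
      N , D/N≤ = archimedean-ε D (½ * ε) (half 0<ε)
      N′ , t≤δ = expTerm-small (0≤+ 0≤p 0≤l) δ 0<δ
      -- `suc (suc N′) ≤ k` both gives `k` the form `suc (suc i)` and puts the term index `suc i`
      -- past `N′`.
      bound : ∀ k → (∣ seq u k ∣ ≤ p × ∣ logSeq (suc m) k ∣ ≤ l) × (suc (suc N′) ℕ.≤ k × N ℕ.≤ k) →
        ∣ expSum (seq u k + logSeq (suc m) k) k - fromℕ (suc m) * expSum (seq u k) k ∣ ≤ ε
      bound = λ where
        (suc (suc i)) ((u≤ , l≤) , (ℕ.s≤s (ℕ.s≤s N′≤i) , N≤k)) → begin
          _ ≤⟨ expSum-+logSeq m i 0≤p u≤ (≤-trans (p≤∣p∣ _) l≤) E≤C ⟩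
          D * (+ 1 / suc (suc (suc i))) + c * expTerm (p + l) (suc i)
            ≤⟨ +-mono-≤ (*-monoˡ-≤-nonNeg D {{nonNegative 0≤D}} (1/-anti N≤k))
                        (*-monoˡ-≤-nonNeg c {{nonNegative 0≤c}} (t≤δ (suc i) (ℕP.m≤n⇒m≤1+n N′≤i))) ⟩
          D * (+ 1 / suc N) + c * δ
            ≤⟨ +-mono-≤ D/N≤ cδ≤ ⟩
          ½ * ε + ½ * ε
            ≡⟨ half+half ε ⟩
          ε ∎
  in eventually-map bound ((u≤p ∩ l≤l) ∩ (eventually-≥ (suc (suc N′)) ∩ eventually-≥ N))
  where open ≤-Reasoning

bounded-*-→0 : ∀ z {x} → x →0 → (λ k → seq z k * x k) →0
bounded-*-→0 z {x} x→0 ε 0<ε =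
  let B , 0≤B , z≤B = bounded z
      δ , 0<δ , Bδ≤ε = shrink B 0≤B ε 0<ε
  in eventually-map (λ { k (z≤ , x≤) → ≤-trans (∣p*q∣≤ {seq z k} z≤ x≤) Bδ≤ε }) (z≤B ∩ x→0 δ 0<δ)

-- The exponents agree at each approximation, `- s * l + l = - (s - 1) * l`, so `exp-+log` applies
-- with `u = - s log n`; the bounded factor `z` keeps the difference null.
/n^-1-→0 : ∀ z s m → let n = suc m in
  (λ k → seq (z *ᴿ n ^ᴿ (-ᴿ (s -ᴿ 1ℝ))) k - fromℕ n * seq (z *ᴿ n ^ᴿ (-ᴿ s)) k) →0
/n^-1-→0 z s m ε 0<ε = eventually-map
  (λ k → subst (λ t → ∣ t ∣ ≤ ε) (eq k))
  (bounded-*-→0 z (exp-+log ((-ᴿ s) *ᴿ log (suc m)) m) ε 0<ε)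
  where
  eq : ∀ k → let l = logSeq (suc m) k in
    seq z k * (expSum (- seq s k * l + l) k - fromℕ (suc m) * expSum (- seq s k * l) k)
    ≡ seq z k * expSum (- (seq s k - 1ℚ) * l) k - fromℕ (suc m) * (seq z k * expSum (- seq s k * l) k)
  eq k = trans
    (cong (λ t → seq z k * (expSum t k - fromℕ (suc m) * expSum (- seq s k * logSeq (suc m) k) k))
      (exponent (seq s k) (logSeq (suc m) k)))
    (distribute (seq z k) (expSum (- (seq s k - 1ℚ) * logSeq (suc m) k) k) (fromℕ (suc m)) (expSum (- seq s k * logSeq (suc m) k) k))
    where
    exponent : ∀ s l → - s * l + l ≡ - (s - 1ℚ) * l
    exponent = solve 2 (λ s l → :- s :* l :+ l := :- (s :- con 1ℚ) :* l) refl
    distribute : ∀ z x n y → z * (x - n * y) ≡ z * x - n * (z * y)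
    distribute = solve 4 (λ z x n y → z :* (x :- n :* y) := z :* x :- n :* (z :* y)) refl

-- Summation by parts and the Cesàro estimate.

-- Indices start at 0, so `a n` stands for the term of index n + 1. Real sums let one argument serve
-- real and imaginary parts.
∑ᴿ : (ℕ → ℝ) → ℕ → ℝ
∑ᴿ a zero    = 0ℝ
∑ᴿ a (suc N) = ∑ᴿ a N +ᴿ a N

re-∑ : ∀ g N → re (∑ g N) ≡ ∑ᴿ (λ n → re (g (suc n))) N
re-∑ g zero    = refl
re-∑ g (suc N) = cong (_+ᴿ re (g (suc N))) (re-∑ g N)

im-∑ : ∀ g N → im (∑ g N) ≡ ∑ᴿ (λ n → im (g (suc n))) N
im-∑ g zero    = refl
im-∑ g (suc N) = cong (_+ᴿ im (g (suc N))) (im-∑ g N)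

∑ᴿ-→0 : ∀ {a} → (∀ n → seq (a n) →0) → ∀ N → seq (∑ᴿ a N) →0
∑ᴿ-→0 a→0 zero    ε 0<ε = 0 , λ _ _ → <⇒≤ 0<ε
∑ᴿ-→0 a→0 (suc N) ε 0<ε = eventually-map
  (λ { k (s≤ , a≤) → subst (_ ≤_) (half+half ε) (∣p+q∣≤ s≤ a≤) })
  (∑ᴿ-→0 a→0 N (½ * ε) (half 0<ε) ∩ a→0 N (½ * ε) (half 0<ε))

-- The Cesàro argument: the initial block costs a constant `C`, each later term at most `ε`. How far
-- out `k` must be may depend on the term, since only finitely many terms occur for each `j`.
∑ᴿ-growth : ∀ D N {C ε} → (∀ n → N ℕ.≤ n → Eventually λ k → ∣ seq (D n) k ∣ ≤ ε) →
  Eventually (λ k → ∣ seq (∑ᴿ D N) k ∣ ≤ C) →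
  ∀ j → Eventually λ k → ∣ seq (∑ᴿ D (j ℕ.+ N)) k ∣ ≤ C + fromℕ j * ε
∑ᴿ-growth D N {C} {ε} D≤ S≤ zero = eventually-map
  (λ k → subst (_ ≤_) (sym (trans (cong (λ t → C + t) (*-zeroˡ ε)) (+-identityʳ C)))) S≤
∑ᴿ-growth D N {C} {ε} D≤ S≤ (suc j) = eventually-map
  (λ { k (s≤ , d≤) → subst (_ ≤_)
    (trans (+-assoc C (fromℕ j * ε) ε) (cong (λ t → C + t) (sym (fromℕ-suc-* j ε)))) (∣p+q∣≤ s≤ d≤) })
  (∑ᴿ-growth D N D≤ S≤ j ∩ D≤ (j ℕ.+ N) (ℕP.m≤n+m N j))

-- Induction on `N`, as `D` changes by `a N` from `N` to `N + 1`. The identity is exact at every `k`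
-- because `c` collects the defects `b n - (n + 1) a n`, which in the application are null sequences
-- rather than 0.
abel-summation : ∀ (a b : ℕ → ℝ) L N k →
  let D : ℕ → ℝ
      D n = ∑ᴿ a n -ᴿ L
      c : ℕ → ℝ
      c n = b n -ᴿ fromℚ (fromℕ (suc n)) *ᴿ a n
  in seq (∑ᴿ b N) k ≡ (fromℕ N * seq (D N) k - seq (∑ᴿ D N) k) + seq (∑ᴿ c N) k
abel-summation a b L zero k = zero-case (seq L k)
  where
  zero-case : ∀ l → 0ℚ ≡ (0ℚ * (0ℚ - l) - 0ℚ) + 0ℚ
  zero-case = solve 1 (λ l → con 0ℚ := (con 0ℚ :* (con 0ℚ :- l) :- con 0ℚ) :+ con 0ℚ) refl
abel-summation a b L (suc N) k = begin
  seq (∑ᴿ b N) k + β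
    ≡⟨ cong (_+ β) (abel-summation a b L N k) ⟩
  ((M * (A - l) - S) + R) + β
    ≡⟨ lemma M A l S R β (seq (a N) k) ⟩
  ((1ℚ + M) * (A + seq (a N) k - l) - (S + (A - l))) + (R + (β - (1ℚ + M) * seq (a N) k))
    ≡⟨ cong (λ m → (m * (A + seq (a N) k - l) - (S + (A - l))) + (R + (β - m * seq (a N) k))) (fromℕ-suc N) ⟨
  (fromℕ (suc N) * (A + seq (a N) k - l) - (S + (A - l))) + (R + (β - fromℕ (suc N) * seq (a N) k)) ∎
  where
  open ≡-Reasoning
  M = fromℕ N
  A = seq (∑ᴿ a N) k
  l = seq L k
  β = seq (b N) k
  S = seq (∑ᴿ (λ n → ∑ᴿ a n -ᴿ L) N) k
  R = seq (∑ᴿ (λ n → b n -ᴿ fromℚ (fromℕ (suc n)) *ᴿ a n) N) k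
  lemma : ∀ M A l S R β α → ((M * (A - l) - S) + R) + β
    ≡ ((1ℚ + M) * (A + α - l) - (S + (A - l))) + (R + (β - (1ℚ + M) * α))
  lemma = solve 7 (λ M A l S R β α → ((M :* (A :- l) :- S) :+ R) :+ β
    := ((con 1ℚ :+ M) :* (A :+ α :- l) :- (S :+ (A :- l))) :+ (R :+ (β :- (con 1ℚ :+ M) :* α))) refl

∑ᴿ-o[N] : ∀ (a b : ℕ → ℝ) L →
  (∀ ε → 0ℚ < ε → Eventually λ n → Eventually λ k → ∣ seq (∑ᴿ a n) k - seq L k ∣ ≤ ε) →
  (∀ n → (λ k → seq (b n) k - fromℕ (suc n) * seq (a n) k) →0) →
  ∀ ε → 0ℚ < ε → Eventually λ N → Eventually λ k → ∣ seq (∑ᴿ b N) k ∣ ≤ fromℕ N * ε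
∑ᴿ-o[N] a b L A→L b≈na ε 0<ε =
  let M , D≤ = A→L η 0<η
      C , 0≤C , C-bound = bounded (∑ᴿ D M)
      P , C≤P = archimedean (C * r)
      -- `P ≤ N` gives `C ≤ N * η`, and `1 ≤ N` absorbs the defect bound `η` into `N * η`.
      bound : ∀ N → M ℕ.≤ N × P ℕ.≤ N × 1 ℕ.≤ N →
        Eventually λ k → ∣ seq (∑ᴿ b N) k ∣ ≤ fromℕ N * ε
      bound N = λ (M≤N , P≤N , 1≤N) → eventually-map
        (λ k (d≤ , s≤ , c≤) → begin
          ∣ seq (∑ᴿ b N) k ∣
            ≡⟨ cong ∣_∣ (abel-summation a b L N k) ⟩
          ∣ (fromℕ N * seq (D N) k - seq (∑ᴿ D N) k) + seq (∑ᴿ c N) k ∣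
            ≤⟨ ∣p+q∣≤ (∣p-q∣≤ (∣p*q∣≤ {fromℕ N} (≤-reflexive (0≤p⇒∣p∣≡p (0≤fromℕ N))) d≤) s≤) c≤ ⟩
          (fromℕ N * η + (C + fromℕ (N ℕ.∸ M) * η)) + η
            ≤⟨ +-mono-≤ (+-monoʳ-≤ (fromℕ N * η) (+-mono-≤ (C≤ C P≤N C≤P)
                 (*-monoʳ-≤-nonNeg η {{nonNegative (<⇒≤ 0<η)}} (fromℕ-mono (ℕP.m∸n≤m N M))))) (η≤ 1≤N) ⟩
          (fromℕ N * η + (fromℕ N * η + fromℕ N * η)) + fromℕ N * η
            ≡⟨ quarters (fromℕ N) ε ⟩
          fromℕ N * ε ∎)
        (D≤ N M≤N ∩
         subst (λ n → Eventually λ k → ∣ seq (∑ᴿ D n) k ∣ ≤ C + fromℕ (N ℕ.∸ M) * η) (ℕP.m∸n+n≡m M≤N)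
           (∑ᴿ-growth D M D≤ C-bound (N ℕ.∸ M)) ∩
         ∑ᴿ-→0 {c} b≈na N η 0<η)
  in eventually-map bound (eventually-≥ M ∩ eventually-≥ P ∩ eventually-≥ 1)
  where
  open ≤-Reasoning
  -- One quarter each for `N * D N`, the initial block `C`, the later terms of the sum of `D`, and
  -- the defects `c`.
  η = ½ * (½ * ε)
  0<η : 0ℚ < η
  0<η = half {½ * ε} (half 0<ε)
  instance
    η≢0 : NonZero η
    η≢0 = >-nonZero 0<η
  r = 1/ η
  D c : ℕ → ℝ
  D n = ∑ᴿ a n -ᴿ L
  c n = b n -ᴿ fromℚ (fromℕ (suc n)) *ᴿ a n
  η≤ : ∀ {N} → 1 ℕ.≤ N → η ≤ fromℕ N * η
  η≤ {N} 1≤N = subst (_≤ fromℕ N * η) (*-identityˡ η)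
    (*-monoʳ-≤-nonNeg η {{nonNegative (<⇒≤ 0<η)}} (fromℕ-mono 1≤N))
  C≤ : ∀ C {P N} → P ℕ.≤ N → C * r ≤ fromℕ P → C ≤ fromℕ N * η
  C≤ C {P} {N} P≤N Cr≤P = subst (_≤ fromℕ N * η)
    (trans (*-assoc C r η) (trans (cong (C *_) (*-inverseˡ η)) (*-identityʳ C)))
    (*-monoʳ-≤-nonNeg η {{nonNegative (<⇒≤ 0<η)}} (≤-trans Cr≤P (fromℕ-mono P≤N)))
  quarters : ∀ n e → let η = ½ * (½ * e) in (n * η + (n * η + n * η)) + n * η ≡ n * e
  quarters = solve 2 (λ n e → let η = con ½ :* (con ½ :* e) in
    (n :* η :+ (n :* η :+ n :* η)) :+ n :* η := n :* e) refl

-- Moduli, integer parts and reciprocals.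

∣p∣*∣p∣≡p*p : ∀ p → ∣ p ∣ * ∣ p ∣ ≡ p * p
∣p∣*∣p∣≡p*p p with ∣p∣≡p∨∣p∣≡-p p
... | inj₁ e = cong₂ _*_ e e
... | inj₂ e = trans (cong₂ _*_ e e) (neg² p)
  where
  neg² : ∀ p → - p * - p ≡ p * p
  neg² = solve 1 (λ p → :- p :* :- p := p :* p) refl

<⇒≱ : ∀ {p q} → p < q → ¬ q ≤ p
<⇒≱ p<q q≤p = <-irrefl refl (<-≤-trans p<q q≤p)

0≤p*p : ∀ p → 0ℚ ≤ p * p
0≤p*p p = subst (0ℚ ≤_) (∣p∣*∣p∣≡p*p p) (0≤* (0≤∣p∣ p) (0≤∣p∣ p))

p*p≤q*q⇒∣p∣≤q : ∀ {p q} → 0ℚ ≤ q → p * p ≤ q * q → ∣ p ∣ ≤ q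
p*p≤q*q⇒∣p∣≤q {p} {q} 0≤q p²≤q² with ∣ p ∣ ≤? q
... | yes p≤q = p≤q
... | no  p≰q = contradiction p²≤q² (<⇒≱ (begin-strict
  q * q           ≤⟨ *-monoˡ-≤-nonNeg q {{nonNegative 0≤q}} (<⇒≤ q<p) ⟩
  q * ∣ p ∣       <⟨ *-monoˡ-<-pos ∣ p ∣ {{positive (≤-<-trans 0≤q q<p)}} q<p ⟩
  ∣ p ∣ * ∣ p ∣   ≡⟨ ∣p∣*∣p∣≡p*p p ⟩
  p * p           ∎))
  where
  open ≤-Reasoning
  q<p = ≰⇒> p≰q

∣z∣<ε⇒ : ∀ z {ε} → 0ℚ ≤ ε → ∣ z ∣< fromℚ ε →
  Eventually λ k → ∣ seq (re z) k ∣ ≤ ε × ∣ seq (im z) k ∣ ≤ ε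
∣z∣<ε⇒ z {ε} 0≤ε (δ , 0<δ , lt) = eventually-map
  (λ k lt → let x = seq (re z) k
                y = seq (im z) k
                x²+y²≤ε² = ≤-trans (p≤p+q (<⇒≤ 0<δ)) lt
            in p*p≤q*q⇒∣p∣≤q {x} 0≤ε (≤-trans (p≤p+q (0≤p*p y)) x²+y²≤ε²)
             , p*p≤q*q⇒∣p∣≤q {y} 0≤ε (≤-trans (subst (y * y ≤_) (+-comm (y * y) (x * x)) (p≤p+q (0≤p*p x))) x²+y²≤ε²))
  lt

-- Components of size δ/2 have squares summing to at most δ²/2, which leaves δ²/2 as the gap
-- demanded by `<ᴿ`.
⇒∣z∣<ε : ∀ z ε {δ} → 0ℚ < δ → Eventually (λ k → δ ≤ seq ε k) →
  Eventually (λ k → ∣ seq (re z) k ∣ ≤ ½ * δ × ∣ seq (im z) k ∣ ≤ ½ * δ) → ∣ z ∣< ε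
⇒∣z∣<ε z ε {δ} 0<δ δ≤ε z≤ = ½ * (δ * δ) , half (0<* 0<δ 0<δ) , eventually-map
  (λ k ((x≤ , y≤) , δ≤) → begin
    seq (re z) k * seq (re z) k + seq (im z) k * seq (im z) k + ½ * (δ * δ)
      ≤⟨ +-monoˡ-≤ (½ * (δ * δ)) (+-mono-≤ (square≤ (seq (re z) k) x≤) (square≤ (seq (im z) k) y≤)) ⟩
    ½ * δ * (½ * δ) + ½ * δ * (½ * δ) + ½ * (δ * δ)
      ≡⟨ collect δ ⟩
    δ * δ
      ≤⟨ *-mono (<⇒≤ 0<δ) (≤-trans (<⇒≤ 0<δ) δ≤) δ≤ δ≤ ⟩
    seq ε k * seq ε k ∎)
  (z≤ ∩ δ≤ε)
  where
  open ≤-Reasoning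
  square≤ : ∀ x {c} → ∣ x ∣ ≤ c → x * x ≤ c * c
  square≤ x {c} x≤c = ≤-trans (p≤∣p∣ (x * x)) (∣p*q∣≤ {x} {x} x≤c x≤c)
  collect : ∀ d → ½ * d * (½ * d) + ½ * d * (½ * d) + ½ * (d * d) ≡ d * d
  collect = solve 1 (λ d → con ½ :* d :* (con ½ :* d) :+ con ½ :* d :* (con ½ :* d) :+ con ½ :* (d :* d) := d :* d) refl

-- The inverted number `δ ⊔ seq x k` is at least `seq x k`, so the bound survives the replacement at
-- every `k` and then cancels.
∣p*1/⊔∣≤ : ∀ x δ (0<δ : 0ℚ < δ) k {p c} → ∣ p ∣ ≤ c * seq x k → 0ℚ ≤ c → ∣ p * 1/⊔ x δ 0<δ k ∣ ≤ c
∣p*1/⊔∣≤ x δ 0<δ k {p} {c} p≤ 0≤c = begin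
  ∣ p * q ∣              ≤⟨ ∣p*q∣≤ {p} (≤-trans p≤ (*-monoˡ-≤-nonNeg c {{nonNegative 0≤c}} (p≤q⊔p δ (seq x k))))
                                   (≤-reflexive (0≤p⇒∣p∣≡p (<⇒≤ (positive⁻¹ q {{1/pos⇒pos m}})))) ⟩
  c * m * q              ≡⟨ *-assoc c m q ⟩
  c * (m * q)            ≡⟨ cong (c *_) (*-inverseʳ m {{pos⇒nonZero m}}) ⟩
  c * 1ℚ                 ≡⟨ *-identityʳ c ⟩
  c                      ∎
  where
  open ≤-Reasoning
  m = δ ⊔ seq x k
  instance
    m>0 : Positive m
    m>0 = ⊔-pos δ (seq x k) 0<δ
  q = 1/⊔ x δ 0<δ k

floor-≥ : ∀ M N x → fromℚ (fromℕ (suc M)) ≤ᴿ x → x <ᴿ fromℚ (fromℕ (suc N)) → M ℕ.≤ N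
floor-≥ M N x X≤x (δ , 0<δ , x<N+1) with M ℕP.≤? N
... | yes M≤N = M≤N
... | no  M≰N =
  -- One common index is enough: tolerance 1 still leaves `M ≤ seq x K < N + 1`, which decides
  -- between integers.
  let K , both = X≤x 1ℚ (positive⁻¹ 1ℚ) ∩ x<N+1
      M+1≤ , <N+1 = both K ℕP.≤-refl
  in contradiction (fromℕ-mono (ℕP.≰⇒> M≰N)) (<⇒≱ (begin-strict
    fromℕ M                     ≡⟨ add-sub 1ℚ (fromℕ M) ⟨
    1ℚ + fromℕ M - 1ℚ           ≡⟨ cong (_- 1ℚ) (fromℕ-suc M) ⟨
    fromℕ (suc M) - 1ℚ          ≤⟨ +-monoˡ-≤ (- 1ℚ) M+1≤ ⟩
    seq x K + 1ℚ - 1ℚ           ≡⟨ cong (_- 1ℚ) (+-comm (seq x K) 1ℚ) ⟩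
    1ℚ + seq x K - 1ℚ           ≡⟨ add-sub 1ℚ (seq x K) ⟩
    seq x K                     ≡⟨ +-identityʳ (seq x K) ⟨
    seq x K + 0ℚ                <⟨ +-monoʳ-< (seq x K) 0<δ ⟩
    seq x K + δ                 ≤⟨ <N+1 ⟩
    fromℕ (suc N)               ∎))
  where open ≤-Reasoning

-- Approximations of `x` may fall slightly below `N`; with tolerance ½ they stay above N - ½, which
-- is at least N/2 once `1 ≤ N`.
½N≤x : ∀ {N} x → 1 ℕ.≤ N → fromℚ (fromℕ N) ≤ᴿ x → Eventually λ k → ½ * fromℕ N ≤ seq x k
½N≤x {N} x 1≤N N≤x = eventually-map
  (λ k N≤ → begin
    ½ * n              ≡⟨ lemma n ⟩
    n - ½ * n          ≤⟨ +-mono-≤ N≤ (neg-antimono-≤ (*-monoˡ-≤-nonNeg ½ (fromℕ-mono 1≤N))) ⟩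
    seq x k + ½ - ½    ≡⟨ cong (_- ½) (+-comm (seq x k) ½) ⟩
    ½ + seq x k - ½    ≡⟨ add-sub ½ (seq x k) ⟩
    seq x k            ∎)
  (N≤x ½ (positive⁻¹ ½))
  where
  open ≤-Reasoning
  n = fromℕ N
  lemma : ∀ n → ½ * n ≡ n - ½ * n
  lemma = solve 1 (λ n → con ½ :* n := n :- con ½ :* n) refl

-- The factor ½ in the hypothesis compensates for having only N/2 as a lower bound for the
-- approximations of `x`.
recip-≤ : ∀ z x (0<x : 0ℝ <ᴿ x) {N c} → 1 ℕ.≤ N → fromℚ (fromℕ N) ≤ᴿ x → 0ℚ < c →
  Eventually (λ k → ∣ seq z k ∣ ≤ fromℕ N * (½ * c)) →
  Eventually λ k → ∣ seq (z *ᴿ recip x 0<x) k ∣ ≤ c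
recip-≤ z x (d , 0<d , _ , _) {N} {c} 1≤N N≤x 0<c z≤ = eventually-map
  (λ k (½N≤ , z≤) → ∣p*1/⊔∣≤ x d 0<d k {seq z k} (begin
    ∣ seq z k ∣          ≤⟨ z≤ ⟩
    fromℕ N * (½ * c)    ≡⟨ lemma (fromℕ N) c ⟩
    c * (½ * fromℕ N)    ≤⟨ *-monoˡ-≤-nonNeg c {{nonNegative (<⇒≤ 0<c)}} ½N≤ ⟩
    c * seq x k          ∎) (<⇒≤ 0<c))
  (½N≤x x 1≤N N≤x ∩ z≤)
  where
  open ≤-Reasoning
  lemma : ∀ n c → n * (½ * c) ≡ c * (½ * n)
  lemma = solve 2 (λ n c → n :* (con ½ :* c) := c :* (con ½ :* n)) refl

-- From partial sums of size o(N) to the estimate o(x).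

mainTheorem6 : (f : ArithmeticFunction) (s : ℝ) → 1ℝ ≤ᴿ s →
    SeriesConverges (f /n^ s) →
    SeriesDiverges (f /n^ (s -ᴿ 1ℝ)) →
    ∑≤ (f /n^ (s -ᴿ 1ℝ)) is-o[x]
mainTheorem6 f s _ (L , A→L) _ ε (δ , 0<δ , ε≥) =
  let M , B≤ = re-small ∩ im-small ∩ eventually-≥ 1
  -- The threshold is `suc M` because `floor-≥` loses one in passing to the integer part.
  in fromℚ (fromℕ (suc M)) , λ { x 0<x X≤x (N , N≤x , x<N+1) →
    let reB , imB , 1≤N = B≤ N (floor-≥ M N x X≤x x<N+1)
    in quotient-small x 0<x N 1≤N N≤x reB imB }
  where
  g h : ArithmeticFunction
  g = f /n^ s
  h = f /n^ (s -ᴿ 1ℝ)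
  -- `δ` is an eventual rational lower bound for `ε`. One half is spent in `recip-≤`, the other on
  -- the component bound δ/2 that `⇒∣z∣<ε` asks for.
  η = ½ * (½ * δ)
  0<η : 0ℚ < η
  0<η = half {½ * δ} (half 0<δ)

  close : ∀ ε → 0ℚ < ε → Eventually λ n → Eventually λ k →
    ∣ seq (re (∑ g n)) k - seq (re L) k ∣ ≤ ε × ∣ seq (im (∑ g n)) k - seq (im L) k ∣ ≤ ε
  close ε 0<ε = eventually-map (λ n → ∣z∣<ε⇒ (∑ g n -ᶜ L) (<⇒≤ 0<ε))
    (A→L (fromℚ ε) (ε , 0<ε , 0 , λ _ _ → ≤-reflexive (+-identityˡ ε)))

  -- Abstracting over the projection allows a single application of `∑ᴿ-o[N]` to cover real and
  -- imaginary parts.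
  o-part : (part : ℂ → ℝ) →
    (∀ N → part (∑ g N) ≡ ∑ᴿ (λ n → part (g (suc n))) N) →
    (∀ N → part (∑ h N) ≡ ∑ᴿ (λ n → part (h (suc n))) N) →
    ∀ l → (∀ n → (λ k → seq (part (h (suc n))) k - fromℕ (suc n) * seq (part (g (suc n))) k) →0) →
    (∀ ε → 0ℚ < ε → Eventually λ n → Eventually λ k → ∣ seq (part (∑ g n)) k - seq l k ∣ ≤ ε) →
    Eventually λ N → Eventually λ k → ∣ seq (part (∑ h N)) k ∣ ≤ fromℕ N * η
  o-part part ∑g ∑h l h≈ng g→l = eventually-map
    (λ N → subst (λ t → Eventually λ k → ∣ seq t k ∣ ≤ fromℕ N * η) (sym (∑h N)))
    (∑ᴿ-o[N] (λ n → part (g (suc n))) (λ n → part (h (suc n))) l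
      (λ ε 0<ε → eventually-map (λ n → subst (λ t → Eventually λ k → ∣ seq t k - seq l k ∣ ≤ ε) (∑g n)) (g→l ε 0<ε))
      h≈ng η 0<η)

  re-small : Eventually λ N → Eventually λ k → ∣ seq (re (∑ h N)) k ∣ ≤ fromℕ N * η
  re-small = o-part re (re-∑ g) (re-∑ h) (re L) (λ n → /n^-1-→0 (re (f (suc n))) s n)
    (λ ε 0<ε → eventually-map (λ _ → eventually-map (λ _ → proj₁)) (close ε 0<ε))

  im-small : Eventually λ N → Eventually λ k → ∣ seq (im (∑ h N)) k ∣ ≤ fromℕ N * η
  im-small = o-part im (im-∑ g) (im-∑ h) (im L) (λ n → /n^-1-→0 (im (f (suc n))) s n)
    (λ ε 0<ε → eventually-map (λ _ → eventually-map (λ _ → proj₂)) (close ε 0<ε))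

  quotient-small : ∀ x (0<x : 0ℝ <ᴿ x) N → 1 ℕ.≤ N → fromℚ (fromℕ N) ≤ᴿ x →
    Eventually (λ k → ∣ seq (re (∑ h N)) k ∣ ≤ fromℕ N * η) →
    Eventually (λ k → ∣ seq (im (∑ h N)) k ∣ ≤ fromℕ N * η) →
    ∣ ∑ h N ·ᶜ recip x 0<x ∣< ε
  quotient-small x 0<x N 1≤N N≤x reB imB =
    ⇒∣z∣<ε (∑ h N ·ᶜ recip x 0<x) ε 0<δ (eventually-map (λ k → subst (_≤ seq ε k) (+-identityˡ δ)) ε≥)
      (recip-≤ (re (∑ h N)) x 0<x 1≤N N≤x (half 0<δ) reB ∩ recip-≤ (im (∑ h N)) x 0<x 1≤N N≤x (half 0<δ) imB)
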